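{- Let $d\in\mathbb{N}$ and let $\mathscr C$ be a graph class of bounded expansion. Then there exists $c\in\mathbb{N}$ such that for every graph $G\in\mathscr C$ there exists a proper coloring of $G$ with $c$ colors satisfying the following condition: for every vertex $u$ of $G$ and every color $i$, the number of vertices of color $i$ that are at distance at most $d$ from $u$ in $G$ is either zero or odd.
   Context: All graphs are finite, simple and undirected. A proper coloring of $G$ is a map from $V(G)$ to a finite set of colors assigning different colors to adjacent vertices. For $d\in\mathbb{N}$, a graph $H$ is a depth-$d$ minor of $G$ if one can assign to each $u\in V(H)$ a connected subgraph $\eta(u)$ of $G$ of radius at most $d$, the subgraphs $\eta(u)$ pairwise vertex-disjoint, such that for each edge $uv$ of $H$ there is an edge of $G$ between $\eta(u)$ and $\eta(v)$. $\nabla_d(G)$ is the maximum average degree of a depth-$d$ minor of $G$. A graph class $\mathscr C$ has bounded expansion if for every $d\in\mathbb{N}$ there is a constant bounding $\nabla_d(G)$ for all $G\in\mathscr C$. -}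

module Defs where

open import Data.Nat using (ℕ; zero; suc; _+_; _*_; _≤_; _%_)
open import Data.Fin using (Fin; zero; suc)
open import Data.Bool using (Bool; true; false; _∧_; _∨_; if_then_else_)
open import Data.Product using (Σ; ∃; ∃-syntax; _×_; _,_)
open import Data.Sum using (_⊎_)
open import Relation.Binary.PropositionalEquality using (_≡_; _≢_)
open import Relation.Nullary using (¬_)
open import Relation.Nullary.Decidable using (⌊_⌋)
open import Data.Fin using (_≟_)

record Graph : Set where
  field
    n    : ℕ
    adj  : Fin n → Fin n → Bool
    sym  : ∀ u v → adj u v ≡ adj v u
    irr  : ∀ u → adj u u ≡ false
open Graph public

count : ∀ {k} → (Fin k → Bool) → ℕ
count {zero}  p = 0
count {suc k} p = (if p zero then 1 else 0) + count (λ x → p (suc x))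

anyFin : ∀ {k} → (Fin k → Bool) → Bool
anyFin {zero}  p = false
anyFin {suc k} p = p zero ∨ anyFin (λ x → p (suc x))

within : (G : Graph) → ℕ → Fin (n G) → Fin (n G) → Bool
within G zero    u v = ⌊ u ≟ v ⌋
within G (suc k) u v = within G k u v ∨ anyFin (λ w → within G k u w ∧ adj G w v)

degSum : Graph → ℕ
degSum G = sumDeg
  where
  sumFin : ∀ {k} → (Fin k → ℕ) → ℕ
  sumFin {zero}  f = 0
  sumFin {suc k} f = f zero + sumFin (λ x → f (suc x))
  sumDeg = sumFin {n G} (λ u → count (λ v → adj G u v))

data WalkIn (G : Graph) (S : Fin (n G) → Bool) : ℕ → Fin (n G) → Fin (n G) → Set where
  here : ∀ {k x} → S x ≡ true → WalkIn G S k x x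
  step : ∀ {k x y z} → S x ≡ true → adj G x y ≡ true → WalkIn G S k y z → WalkIn G S (suc k) x z

ConnRadiusAtMost : (G : Graph) → (Fin (n G) → Bool) → ℕ → Set
ConnRadiusAtMost G S r =
  ∃[ c ] (S c ≡ true × (∀ x → S x ≡ true → WalkIn G S r c x))

DepthMinor : ℕ → Graph → Graph → Set
DepthMinor r H G =
  Σ (Fin (n H) → Fin (n G) → Bool) λ η →
    (∀ u → ConnRadiusAtMost G (η u) r)
  × (∀ u v → u ≢ v → ∀ x → ¬ (η u x ≡ true × η v x ≡ true))
  × (∀ u v → adj H u v ≡ true →
       ∃[ x ] ∃[ y ] (η u x ≡ true × η v y ≡ true × adj G x y ≡ true))

GraphClass : Set₁
GraphClass = Graph → Set

-- Bounded expansion: for every r there is a bound N with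
-- avg-degree(H) = degSum H / |V(H)| ≤ N for all depth-r minors H of graphs in C.
BoundedExpansion : GraphClass → Set
BoundedExpansion C =
  ∀ (r : ℕ) → ∃[ N ] (∀ G → C G → ∀ H → DepthMinor r H G → degSum H ≤ N * n H)

Proper : (G : Graph) → ∀ {c} → (Fin (n G) → Fin c) → Set
Proper G col = ∀ u v → adj G u v ≡ true → col u ≢ col v

ballColorCount : (G : Graph) → ∀ {c} → (Fin (n G) → Fin c) → ℕ → Fin (n G) → Fin c → ℕ
ballColorCount G col d u i = count (λ v → within G d u v ∧ ⌊ col v ≟ i ⌋)

ZeroOrOdd : ℕ → Set
ZeroOrOdd k = k ≡ 0 ⊎ k % 2 ≡ 1

{-# OPTIONS --safe #-}
module Submission where

-- Bounded density of shallow minors yields, for every r, a linear order in which every vertex v weakly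
-- r-reaches boundedly many vertices.  With r = 4d + 1, label the vertices so that v differs from every other
-- vertex it weakly r-reaches, and let the type of v record the labels, the order and the depths of the
-- vertices that v weakly d-reaches.  Within a type these vertices form a forest: the k-th lowest one
-- determines all lower ones.  A shortest path of length at most d passes through a lowest vertex, which both
-- ends weakly d-reach; therefore a d-ball meets a type either in nothing or in all leaves below one node of
-- the forest.  It remains to colour the leaves of a forest of bounded height so that every colour occurs zero
-- or an odd number of times below every node: going up level by level, whenever a colour occurs an even
-- number of times below a node, recolour it below one child.
--
-- The order is built from its last vertex.  Let S be the set of vertices not yet placed, and take a maximal
-- system of disjoint short connections between distinct pairs of S, charged to cells around the vertices of
-- S.  Contracting the cells gives a shallow minor, so the system uses O(|S|) vertices and some linearly large
-- I ⊆ S is pairwise unconnected.  By maximality the r-balls around the vertices of I that avoid all used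
-- vertices are disjoint; contracting them bounds the number of used vertices that an average ball touches.
-- For some x ∈ I these are few, and every walk of length at most r from x back to S must visit one of them.
-- Such hitting sets bound weak reachability by iteration along the walk.

open import Defs
open import Data.Bool using (Bool; true; false; _∧_; _∨_; not; if_then_else_; T)
open import Data.Bool.Properties using (∨-zeroʳ; ¬-not; not-¬)
open import Data.Empty using (⊥-elim)
open import Data.Fin using (Fin; zero; suc; _≟_; combine; remQuot; toℕ; fromℕ<; funToFin; finToFun)
open import Data.Fin.Properties using (any?; suc-injective; combine-injective; combine-injectiveˡ; combine-injectiveʳ; combine-surjective; remQuot-combine; finToFun-funToFin; toℕ-fromℕ<)
open import Data.List using (List; []; _∷_)
open import Data.List.Properties using (∷-injectiveˡ; ∷-injectiveʳ) renaming (≡-dec to List-≡-dec)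
open import Data.Maybe using (Maybe; just; nothing; is-just; map)
open import Data.Maybe.Properties using (just-injective) renaming (≡-dec to Maybe-≡-dec)
open import Data.Nat using (ℕ; zero; suc; pred; _+_; _*_; _^_; _%_; _≤_; _<_; z≤n; s≤s; s≤s⁻¹; _≤?_; _<?_; _≤ᵇ_)
open import Data.Nat.DivMod using (%-distribˡ-+; m%n<n)
open import Data.Nat.Induction using (<-rec)
open import Data.Nat.Properties renaming (_≟_ to _≟ℕ_) hiding (suc-injective)
open import Data.Nat.Tactic.RingSolver using (solve-∀)
open import Data.Product using (∃-syntax; _×_; _,_; proj₁; proj₂)
open import Data.Sum using (_⊎_; inj₁; inj₂; [_,_]′)
open import Function using (_∘_; _∋_)
open import Relation.Binary.Definitions using (DecidableEquality; tri<; tri≈; tri>)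
open import Relation.Binary.PropositionalEquality using (_≡_; _≢_; refl; trans; cong; cong₂; subst; subst₂) renaming (sym to ≡-sym)
open import Relation.Nullary using (¬_; Dec; yes; no)
open import Relation.Nullary.Decidable using (⌊_⌋; _×-dec_; ¬?; map′)

-- Booleans

⌊⌋⁺ : ∀ {P : Set} (p? : Dec P) → P → ⌊ p? ⌋ ≡ true
⌊⌋⁺ (yes _) _ = refl
⌊⌋⁺ (no ¬p) p = ⊥-elim (¬p p)

⌊⌋⁻ : ∀ {P : Set} (p? : Dec P) → ⌊ p? ⌋ ≡ true → P
⌊⌋⁻ (yes p) _ = p

⌊⌋-false : ∀ {P : Set} (p? : Dec P) → ¬ P → ⌊ p? ⌋ ≡ false
⌊⌋-false (yes p) ¬p = ⊥-elim (¬p p)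
⌊⌋-false (no _)  _  = refl

≡true-cong : ∀ {a b} → (a ≡ true → b ≡ true) → (b ≡ true → a ≡ true) → a ≡ b
≡true-cong {true}  {true}  _ _ = refl
≡true-cong {false} {false} _ _ = refl
≡true-cong {true}  {false} f _ = ≡-sym (f refl)
≡true-cong {false} {true}  _ g = g refl

∧⁺ : ∀ {a b} → a ≡ true → b ≡ true → a ∧ b ≡ true
∧⁺ refl refl = refl

∧⁻ : ∀ a {b} → a ∧ b ≡ true → a ≡ true × b ≡ true
∧⁻ true eq = refl , eq

∨⁺ˡ : ∀ {a b} → a ≡ true → a ∨ b ≡ true
∨⁺ˡ refl = refl

∨⁺ʳ : ∀ {a b} → b ≡ true → a ∨ b ≡ true
∨⁺ʳ {a} refl = ∨-zeroʳ a

∨⁻ : ∀ a {b} → a ∨ b ≡ true → a ≡ true ⊎ b ≡ true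
∨⁻ true  _ = inj₁ refl
∨⁻ false p = inj₂ p

not⁺ : ∀ {a} → ¬ a ≡ true → not a ≡ true
not⁺ {true}  ¬a = ⊥-elim (¬a refl)
not⁺ {false} _  = refl

not⁻ : ∀ a → not a ≡ true → ¬ a ≡ true
not⁻ false _ ()

isTrue? : ∀ a → Dec (a ≡ true)
isTrue? true  = yes refl
isTrue? false = no λ ()

-- Sums and cardinalities over Fin

∑ : ∀ {k} → (Fin k → ℕ) → ℕ
∑ {zero}  f = 0
∑ {suc k} f = f zero + ∑ (λ x → f (suc x))

∑∈ : ∀ {k} → (Fin k → Bool) → (Fin k → ℕ) → ℕ
∑∈ S f = ∑ (λ x → if S x then f x else 0)

∑-cong : ∀ {k} {f g : Fin k → ℕ} → (∀ x → f x ≡ g x) → ∑ f ≡ ∑ g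
∑-cong {zero}  _  = refl
∑-cong {suc k} eq = cong₂ _+_ (eq zero) (∑-cong (eq ∘ suc))

∑-mono-≤ : ∀ {k} {f g : Fin k → ℕ} → (∀ x → f x ≤ g x) → ∑ f ≤ ∑ g
∑-mono-≤ {zero}  _  = z≤n
∑-mono-≤ {suc k} le = +-mono-≤ (le zero) (∑-mono-≤ (le ∘ suc))

∑-mono-< : ∀ {k} {f g : Fin k → ℕ} → (∀ x → f x ≤ g x) → ∀ x → f x < g x → ∑ f < ∑ g
∑-mono-< le zero    lt = +-mono-<-≤ lt (∑-mono-≤ (le ∘ suc))
∑-mono-< le (suc x) lt = +-mono-≤-< (le zero) (∑-mono-< (le ∘ suc) x lt)

if-mono-≤ : ∀ {a b : Bool} {m n : ℕ} → (a ≡ true → b ≡ true) → (a ≡ true → m ≤ n) →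
            (if a then m else 0) ≤ (if b then n else 0)
if-mono-≤ {false} _ _ = z≤n
if-mono-≤ {true} a⇒b le rewrite a⇒b refl = le refl

∑∈-mono-≤ : ∀ {k} {S T : Fin k → Bool} {f g : Fin k → ℕ} →
            (∀ x → S x ≡ true → T x ≡ true) → (∀ x → S x ≡ true → f x ≤ g x) → ∑∈ S f ≤ ∑∈ T g
∑∈-mono-≤ S⊆T le = ∑-mono-≤ (λ x → if-mono-≤ (S⊆T x) (le x))

∑∈-mono-< : ∀ {k} {S : Fin k → Bool} {f g : Fin k → ℕ} →
            (∀ x → f x ≤ g x) → ∀ x → S x ≡ true → f x < g x → ∑∈ S f < ∑∈ S g
∑∈-mono-< {S = S} {f} {g} le x Sx lt = ∑-mono-< (λ y → if-mono-≤ {S y} (λ p → p) (λ _ → le y)) x strict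
  where
  strict : (if S x then f x else 0) < (if S x then g x else 0)
  strict rewrite Sx = lt

count≡∑ : ∀ {k} (p : Fin k → Bool) → count p ≡ ∑∈ p (λ _ → 1)
count≡∑ {zero}  p = refl
count≡∑ {suc k} p = cong ((if p zero then 1 else 0) +_) (count≡∑ (p ∘ suc))

count-mono : ∀ {k} {p q : Fin k → Bool} → (∀ x → p x ≡ true → q x ≡ true) → count p ≤ count q
count-mono {p = p} {q} p⊆q rewrite count≡∑ p | count≡∑ q = ∑∈-mono-≤ p⊆q (λ _ _ → ≤-refl)

count-mono-< : ∀ {k} {p q : Fin k → Bool} → (∀ x → p x ≡ true → q x ≡ true) →
               ∀ x → p x ≡ false → q x ≡ true → count p < count q
count-mono-< {p = p} {q} p⊆q x px qx rewrite count≡∑ p | count≡∑ q =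
  ∑-mono-< (λ y → if-mono-≤ (p⊆q y) (λ _ → ≤-refl)) x strict
  where
  strict : (if p x then 1 else 0) < (if q x then 1 else 0)
  strict rewrite px | qx = ≤-refl

count-cong : ∀ {k} {p q : Fin k → Bool} →
             (∀ x → p x ≡ true → q x ≡ true) → (∀ x → q x ≡ true → p x ≡ true) → count p ≡ count q
count-cong p⊆q q⊆p = ≤-antisym (count-mono p⊆q) (count-mono q⊆p)

count-none : ∀ {k} {p : Fin k → Bool} → (∀ x → ¬ p x ≡ true) → count p ≡ 0
count-none {zero}      _    = refl
count-none {suc k} {p} none rewrite ¬-not (none zero) = count-none (none ∘ suc)

count-all : ∀ {k} → count {k} (λ _ → true) ≡ k
count-all {zero}  = refl
count-all {suc k} = cong suc count-all

count-pos : ∀ {k} {p : Fin k → Bool} x → p x ≡ true → 0 < count p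
count-pos {k} {p} x px = subst (_< count p) (count-none {k} {p = λ _ → false} (λ _ ())) (count-mono-< {p = λ _ → false} (λ _ ()) x refl px)

count-witness : ∀ {k} {p : Fin k → Bool} → 0 < count p → ∃[ x ] p x ≡ true
count-witness {suc k} {p} pos with p zero in eq
... | true  = zero , eq
... | false with count-witness pos
...   | x , px = suc x , px

count-split : ∀ {k} (p q : Fin k → Bool) →
              count p ≡ count (λ x → p x ∧ q x) + count (λ x → p x ∧ not (q x))
count-split {zero}  p q = refl
count-split {suc k} p q with p zero | q zero
... | false | _     = count-split (p ∘ suc) (q ∘ suc)
... | true  | true  = cong suc (count-split (p ∘ suc) (q ∘ suc))
... | true  | false = trans (cong suc (count-split (p ∘ suc) (q ∘ suc))) (≡-sym (+-suc _ _))

count-∨ : ∀ {k} (p q : Fin k → Bool) → count (λ x → p x ∨ q x) ≤ count p + count q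
count-∨ p q = begin
  count (λ x → p x ∨ q x)
    ≡⟨ count-split _ p ⟩
  count (λ x → (p x ∨ q x) ∧ p x) + count (λ x → (p x ∨ q x) ∧ not (p x))
    ≤⟨ +-mono-≤ (count-mono (λ x → proj₂ ∘ ∧⁻ (p x ∨ q x))) (count-mono other) ⟩
  count p + count q ∎
  where
  open ≤-Reasoning
  other : ∀ x → (p x ∨ q x) ∧ not (p x) ≡ true → q x ≡ true
  other x eq with ∧⁻ (p x ∨ q x) eq
  ... | p∨q , ¬px = [ ⊥-elim ∘ not⁻ (p x) ¬px , (λ qx → qx) ]′ (∨⁻ (p x) p∨q)

∑∈-≤-const : ∀ {k} {S : Fin k → Bool} {f m} → (∀ x → S x ≡ true → f x ≤ m) → ∑∈ S f ≤ count S * m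
∑∈-≤-const {zero}          _  = z≤n
∑∈-≤-const {suc k} {S} {f} {m} le with S zero in eq
... | true  = +-mono-≤ (le zero eq) (∑∈-≤-const (le ∘ suc))
... | false = ∑∈-≤-const (le ∘ suc)

∑∈-≥-const : ∀ {k} {S : Fin k → Bool} {f m} → (∀ x → S x ≡ true → m ≤ f x) → count S * m ≤ ∑∈ S f
∑∈-≥-const {zero}          _  = z≤n
∑∈-≥-const {suc k} {S} {f} {m} le with S zero in eq
... | true  = +-mono-≤ (le zero eq) (∑∈-≥-const (le ∘ suc))
... | false = ∑∈-≥-const (le ∘ suc)

∃-below-average : ∀ {k} (S : Fin k → Bool) (f : Fin k → ℕ) m → 0 < count S → ∑∈ S f ≤ m * count S →
                  ∃[ x ] (S x ≡ true × f x ≤ m)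
∃-below-average S f m pos le with any? (λ x → isTrue? (S x) ×-dec (f x ≤? m))
... | yes found = found
... | no none = ⊥-elim (<⇒≱ too-big le)
  where
  open ≤-Reasoning
  too-big : m * count S < ∑∈ S f
  too-big = begin-strict
    m * count S         ≡⟨ *-comm m _ ⟩
    count S * m         <⟨ m<n+m _ pos ⟩
    count S + count S * m ≡⟨ *-suc (count S) m ⟨
    count S * suc m     ≤⟨ ∑∈-≥-const (λ x Sx → ≰⇒> (λ fx≤m → none (x , Sx , fx≤m))) ⟩
    ∑∈ S f              ∎

count-⋃ : ∀ {k l} {Z : Fin k → Bool} {P : Fin l → Bool} (Q : Fin k → Fin l → Bool) →
          (∀ s → P s ≡ true → ∃[ z ] (Z z ≡ true × Q z s ≡ true)) → count P ≤ ∑∈ Z (λ z → count (Q z))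
count-⋃ {zero} {P = P} Q cover = ≤-reflexive (count-none {p = P} λ s Ps → no-fin (proj₁ (cover s Ps)))
  where
  no-fin : ¬ Fin 0
  no-fin ()
count-⋃ {suc k} {Z = Z} {P} Q cover = begin
  count P
    ≡⟨ count-split P A ⟩
  count (λ s → P s ∧ A s) + count (λ s → P s ∧ not (A s))
    ≤⟨ +-mono-≤ first (count-⋃ (Q ∘ suc) rest) ⟩
  ∑∈ Z (λ z → count (Q z)) ∎
  where
  open ≤-Reasoning
  A : Fin _ → Bool
  A s = Z zero ∧ Q zero s
  first : count (λ s → P s ∧ A s) ≤ (if Z zero then count (Q zero) else 0)
  first with Z zero
  ... | true  = count-mono (λ s → proj₂ ∘ ∧⁻ (P s))
  ... | false = ≤-reflexive (count-none (λ s eq → not-¬ (proj₂ (∧⁻ (P s) eq)) refl))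
  rest : ∀ s → P s ∧ not (A s) ≡ true → ∃[ z ] (Z (suc z) ≡ true × Q (suc z) s ≡ true)
  rest s eq with ∧⁻ (P s) eq
  ... | Ps , ¬As with cover s Ps
  ...   | zero  , Zz , Qz = ⊥-elim (not⁻ (A s) ¬As (∧⁺ Zz Qz))
  ...   | suc z , Zz , Qz = z , Zz , Qz

count-≟ : ∀ {k} (x : Fin k) → count (λ y → ⌊ y ≟ x ⌋) ≤ 1
count-≟ {suc k} zero = s≤s (≤-reflexive (count-none {k} (λ y ())))
count-≟ {suc k} (suc x) = ≤-trans (count-mono (λ y eq → ⌊⌋⁺ (y ≟ x) (suc-injective (⌊⌋⁻ (suc y ≟ suc x) eq)))) (count-≟ x)

-- Enumeration of a subset

emb : ∀ {k} (S : Fin k → Bool) → Fin (count S) → Fin k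
emb {suc k} S i with S zero
emb {suc k} S zero    | true  = zero
emb {suc k} S (suc i) | true  = suc (emb (S ∘ suc) i)
emb {suc k} S i       | false = suc (emb (S ∘ suc) i)

emb-∈ : ∀ {k} (S : Fin k → Bool) i → S (emb S i) ≡ true
emb-∈ {suc k} S i with S zero in eq
emb-∈ {suc k} S zero    | true  = eq
emb-∈ {suc k} S (suc i) | true  = emb-∈ (S ∘ suc) i
emb-∈ {suc k} S i       | false = emb-∈ (S ∘ suc) i

emb-injective : ∀ {k} (S : Fin k → Bool) i j → emb S i ≡ emb S j → i ≡ j
emb-injective {suc k} S i j eq with S zero
emb-injective {suc k} S zero    zero    eq | true  = refl
emb-injective {suc k} S (suc i) (suc j) eq | true  = cong suc (emb-injective (S ∘ suc) i j (suc-injective eq))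
emb-injective {suc k} S i       j       eq | false = emb-injective (S ∘ suc) i j (suc-injective eq)

∑-emb : ∀ {k} (S : Fin k → Bool) f → ∑ (λ i → f (emb S i)) ≡ ∑∈ S f
∑-emb {zero}  S f = refl
∑-emb {suc k} S f with S zero
... | true  = cong (f zero +_) (∑-emb (S ∘ suc) (f ∘ suc))
... | false = ∑-emb (S ∘ suc) (f ∘ suc)

count-emb : ∀ {k} (S p : Fin k → Bool) → count (λ i → p (emb S i)) ≡ count (λ x → S x ∧ p x)
count-emb {zero}  S p = refl
count-emb {suc k} S p with S zero
... | true  = cong ((if p zero then 1 else 0) +_) (count-emb (S ∘ suc) (p ∘ suc))
... | false = count-emb (S ∘ suc) (p ∘ suc)

-- Walks

module _ {G : Graph} where

  private
    V : Set
    V = Fin (n G)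

  walk-start : ∀ {A k x z} → WalkIn G A k x z → A x ≡ true
  walk-start (here Ax)     = Ax
  walk-start (step Ax _ _) = Ax

  walk-end : ∀ {A k x z} → WalkIn G A k x z → A z ≡ true
  walk-end (here Ax)    = Ax
  walk-end (step _ _ p) = walk-end p

  walk-⊆ : ∀ {A B k x z} → (∀ v → A v ≡ true → B v ≡ true) → WalkIn G A k x z → WalkIn G B k x z
  walk-⊆ A⊆B (here Ax)     = here (A⊆B _ Ax)
  walk-⊆ A⊆B (step Ax e p) = step (A⊆B _ Ax) e (walk-⊆ A⊆B p)

  walk-≤ : ∀ {A k l x z} → k ≤ l → WalkIn G A k x z → WalkIn G A l x z
  walk-≤ _         (here Ax)     = here Ax
  walk-≤ (s≤s k≤l) (step Ax e p) = step Ax e (walk-≤ k≤l p)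

  walk-++ : ∀ {A j k x y z} → WalkIn G A j x y → WalkIn G A k y z → WalkIn G A (j + k) x z
  walk-++ {j = j} (here _) q = walk-≤ (m≤n+m _ j) q
  walk-++ (step Ax e p) q    = step Ax e (walk-++ p q)

  walk-snoc : ∀ {A k x y z} → WalkIn G A k x y → adj G y z ≡ true → A z ≡ true → WalkIn G A (suc k) x z
  walk-snoc (here Ax)     e Az = step Ax e (here Az)
  walk-snoc (step Ax f p) e Az = step Ax f (walk-snoc p e Az)

  walk-reverse : ∀ {A k x z} → WalkIn G A k x z → WalkIn G A k z x
  walk-reverse (here Ax)                  = here Ax
  walk-reverse (step {x = x} {y} Ax e p) = walk-snoc (walk-reverse p) (trans (sym G y x) e) Ax

  vertices : ∀ {A k x z} → WalkIn G A k x z → V → Bool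
  vertices (here {x = x} _)     v = ⌊ v ≟ x ⌋
  vertices (step {x = x} _ _ p) v = ⌊ v ≟ x ⌋ ∨ vertices p v

  vertices-⊆ : ∀ {A k x z} (p : WalkIn G A k x z) v → vertices p v ≡ true → A v ≡ true
  vertices-⊆ (here {x = x} Ax) v eq with refl ← ⌊⌋⁻ (v ≟ x) eq = Ax
  vertices-⊆ (step {x = x} Ax _ p) v eq with ∨⁻ ⌊ v ≟ x ⌋ eq
  ... | inj₁ v≡x with refl ← ⌊⌋⁻ (v ≟ x) v≡x = Ax
  ... | inj₂ v∈p = vertices-⊆ p v v∈p

  vertices-end : ∀ {A k x z} (p : WalkIn G A k x z) → vertices p z ≡ true
  vertices-end (here {x = x} _)     = ⌊⌋⁺ (x ≟ x) refl
  vertices-end (step _ _ p) = ∨⁺ʳ (vertices-end p)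

  -- Prefixes run inside the vertex set of the walk itself, so this set can be handed over as part
  -- of a branch set, with the start as centre and radius `k`.
  walk-prefix : ∀ {A k x z} (p : WalkIn G A k x z) v → vertices p v ≡ true → WalkIn G (vertices p) k x v
  walk-prefix (here {x = x} Ax) v eq with refl ← ⌊⌋⁻ (v ≟ x) eq = here (⌊⌋⁺ (x ≟ x) refl)
  walk-prefix (step {x = x} Ax e p) v eq with ∨⁻ ⌊ v ≟ x ⌋ eq
  ... | inj₁ v≡x with refl ← ⌊⌋⁻ (v ≟ x) v≡x = here (∨⁺ˡ (⌊⌋⁺ (x ≟ x) refl))
  ... | inj₂ v∈p = step (∨⁺ˡ (⌊⌋⁺ (x ≟ x) refl)) e (walk-⊆ (λ _ → ∨⁺ʳ) (walk-prefix p v v∈p))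

  count-vertices : ∀ {A k x z} (p : WalkIn G A k x z) → count (vertices p) ≤ suc k
  count-vertices (here {x = x} _)     = ≤-trans (count-≟ x) (s≤s z≤n)
  count-vertices (step {x = x} _ _ p) =
    ≤-trans (count-∨ (λ v → ⌊ v ≟ x ⌋) (vertices p)) (+-mono-≤ (count-≟ x) (count-vertices p))

walk? : ∀ G A k x z → Dec (WalkIn G A k x z)
walk? G A k x z with isTrue? (A x)
... | no ¬Ax = no (¬Ax ∘ walk-start)
... | yes Ax with x ≟ z
...   | yes refl = yes (here Ax)
walk? G A zero    x z | yes Ax | no x≢z = no λ { (here _) → x≢z refl }
walk? G A (suc k) x z | yes Ax | no x≢z =
  map′ (λ { (y , e , p) → step Ax e p })
       (λ { (here _) → ⊥-elim (x≢z refl) ; (step _ e p) → _ , e , p })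
       (any? (λ y → isTrue? (adj G x y) ×-dec walk? G A k y z))

walk-in-ball : ∀ {G A k x z} → WalkIn G A k x z → WalkIn G (λ v → ⌊ walk? G A k x v ⌋) k x z
walk-in-ball {G} {A} {k} {x} p =
  walk-⊆ (λ v v∈p → ⌊⌋⁺ (walk? G A k x v) (walk-⊆ (vertices-⊆ p) (walk-prefix p v v∈p)))
         (walk-prefix p _ (vertices-end p))

module _ (G : Graph) where

  private
    V : Set
    V = Fin (n G)

  Touching : (η : V → V → Bool) → V → V → Set
  Touching η x y = x ≢ y × (∃[ a ] ∃[ b ] (η x a ≡ true × η y b ≡ true × adj G a b ≡ true))

  touching? : ∀ η x y → Dec (Touching η x y)
  touching? η x y =
    ¬? (x ≟ y) ×-dec any? (λ a → any? (λ b → isTrue? (η x a) ×-dec (isTrue? (η y b) ×-dec isTrue? (adj G a b))))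

  touching-sym : ∀ {η x y} → Touching η x y → Touching η y x
  touching-sym (x≢y , a , b , ηa , ηb , e) = (x≢y ∘ ≡-sym) , b , a , ηb , ηa , trans (sym G b a) e

  degIn : (V → Bool) → (V → V → Bool) → V → ℕ
  degIn T η x = count (λ y → T y ∧ ⌊ touching? η x y ⌋)

-- Densities of shallow minors

-- degSum sums with a function that is local to its definition; unification recovers it here.
mutual
  degSum-summation : Graph → ∀ k → (Fin k → ℕ) → ℕ
  degSum-summation = _

  degSum-unfold : ∀ G → degSum G ≡ degSum-summation G (n G) (λ u → count (adj G u))
  degSum-unfold G with n G | (λ u → count (adj G u))
  ... | _ | _ = refl

degSum-summation≡∑ : ∀ G k f → degSum-summation G k f ≡ ∑ f
degSum-summation≡∑ G zero    f = refl
degSum-summation≡∑ G (suc k) f = cong (f zero +_) (degSum-summation≡∑ G k _)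

degSum≡∑ : ∀ G → degSum G ≡ ∑ (λ u → count (adj G u))
degSum≡∑ G = trans (degSum-unfold G) (degSum-summation≡∑ G _ (λ u → count (adj G u)))

MinorDensity : Graph → ℕ → ℕ → Set
MinorDensity G r N = ∀ H → DepthMinor r H G → degSum H ≤ N * n H

record BranchSets (G : Graph) (r : ℕ) (T : Fin (n G) → Bool) (η : Fin (n G) → Fin (n G) → Bool) : Set where
  field
    centre   : ∀ x → T x ≡ true → η x x ≡ true
    radius   : ∀ x w → T x ≡ true → η x w ≡ true → WalkIn G (η x) r x w
    disjoint : ∀ x y w → T x ≡ true → T y ≡ true → η x w ≡ true → η y w ≡ true → x ≡ y

-- Enumerating `T` by `emb` makes the contracted graph a `Graph`, and `degIn` summed over `T` is
-- exactly its degree sum. From here on density is used only in this form, on vertices of `G`.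
branchSets-density : ∀ {G r T η} N → MinorDensity G r N → BranchSets G r T η →
                     ∑∈ T (degIn G T η) ≤ N * count T
branchSets-density {G} {r} {T} {η} N bound bs = subst (_≤ N * count T) degSum-H (bound H minor)
  where
  open BranchSets bs
  H : Graph
  H .n       = count T
  H .adj i j = ⌊ touching? G η (emb T i) (emb T j) ⌋
  H .sym i j = ≡true-cong
    (λ eq → ⌊⌋⁺ (touching? G η (emb T j) (emb T i)) (touching-sym G {η} (⌊⌋⁻ (touching? G η (emb T i) (emb T j)) eq)))
    (λ eq → ⌊⌋⁺ (touching? G η (emb T i) (emb T j)) (touching-sym G {η} (⌊⌋⁻ (touching? G η (emb T j) (emb T i)) eq)))
  H .irr i   = ⌊⌋-false (touching? G η (emb T i) (emb T i)) (λ t → proj₁ t refl)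

  minor : DepthMinor r H G
  minor = (η ∘ emb T)
        , (λ i → emb T i , centre _ (emb-∈ T i) , (λ w → radius _ w (emb-∈ T i)))
        , (λ i j i≢j w (ηi , ηj) → i≢j (emb-injective T i j (disjoint _ _ w (emb-∈ T i) (emb-∈ T j) ηi ηj)))
        , (λ i j e → proj₂ (⌊⌋⁻ (touching? G η (emb T i) (emb T j)) e))

  degSum-H : degSum H ≡ ∑∈ T (degIn G T η)
  degSum-H = trans (degSum≡∑ H)
    (trans (∑-cong (λ i → count-emb T (λ y → ⌊ touching? G η (emb T i) y ⌋))) (∑-emb T (degIn G T η)))

-- Sparse relations have large independent sets

record Independent {k} (E : Fin k → Fin k → Bool) (N : ℕ) (S : Fin k → Bool) : Set where
  field
    I         : Fin k → Bool
    I⊆S       : ∀ x → I x ≡ true → S x ≡ true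
    separated : ∀ x y → I x ≡ true → I y ≡ true → x ≢ y → ¬ E x y ≡ true
    large     : count S ≤ suc N * count I

module _ {k} (E : Fin k → Fin k → Bool) (E-sym : ∀ x y → E x y ≡ true → E y x ≡ true) (N : ℕ) where

  remaining : (Fin k → Bool) → Fin k → Fin k → Bool
  remaining T x y = T y ∧ not (⌊ y ≟ x ⌋ ∨ E x y)

  remaining-⊆ : ∀ T x y → remaining T x y ≡ true → T y ≡ true
  remaining-⊆ T x y = proj₁ ∘ ∧⁻ (T y)

  remaining-far : ∀ T x y → remaining T x y ≡ true → ¬ (⌊ y ≟ x ⌋ ∨ E x y ≡ true)
  remaining-far T x y T′y = not⁻ (⌊ y ≟ x ⌋ ∨ E x y) (proj₂ (∧⁻ (T y) T′y))

  remaining-self : ∀ T x → remaining T x x ≡ false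
  remaining-self T x = ¬-not λ T′x → remaining-far T x x T′x (∨⁺ˡ (⌊⌋⁺ (x ≟ x) refl))

  independent-add : ∀ T x → T x ≡ true → count (λ y → T y ∧ E x y) ≤ N →
                    Independent E N (remaining T x) → Independent E N T
  independent-add T x Tx deg≤N rec = record
    { I = I ; I⊆S = I⊆T ; separated = separated ; large = large }
    where
    module R = Independent rec
    I : Fin k → Bool
    I y = ⌊ y ≟ x ⌋ ∨ R.I y
    I⊆T : ∀ y → I y ≡ true → T y ≡ true
    I⊆T y Iy with ∨⁻ ⌊ y ≟ x ⌋ Iy
    ... | inj₁ y≡x with refl ← ⌊⌋⁻ (y ≟ x) y≡x = Tx
    ... | inj₂ RIy = remaining-⊆ T x y (R.I⊆S y RIy)
    x-far : ∀ y → R.I y ≡ true → ¬ E x y ≡ true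
    x-far y RIy Exy = remaining-far T x y (R.I⊆S y RIy) (∨⁺ʳ Exy)
    separated : ∀ y z → I y ≡ true → I z ≡ true → y ≢ z → ¬ E y z ≡ true
    separated y z Iy Iz y≢z with ∨⁻ ⌊ y ≟ x ⌋ Iy | ∨⁻ ⌊ z ≟ x ⌋ Iz
    ... | inj₁ y≡x | inj₁ z≡x = ⊥-elim (y≢z (trans (⌊⌋⁻ (y ≟ x) y≡x) (≡-sym (⌊⌋⁻ (z ≟ x) z≡x))))
    ... | inj₁ y≡x | inj₂ RIz with refl ← ⌊⌋⁻ (y ≟ x) y≡x = x-far z RIz
    ... | inj₂ RIy | inj₁ z≡x with refl ← ⌊⌋⁻ (z ≟ x) z≡x = x-far y RIy ∘ E-sym y z
    ... | inj₂ RIy | inj₂ RIz = R.separated y z RIy RIz y≢z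
    removed : Fin k → Bool
    removed y = T y ∧ (⌊ y ≟ x ⌋ ∨ E x y)
    count-removed : count removed ≤ suc N
    count-removed = ≤-trans
      (count-mono {q = λ y → ⌊ y ≟ x ⌋ ∨ (T y ∧ E x y)} λ y eq → let Ty , near = ∧⁻ (T y) eq in
        [ ∨⁺ˡ , (λ Exy → ∨⁺ʳ (∧⁺ Ty Exy)) ]′ (∨⁻ ⌊ y ≟ x ⌋ near))
      (≤-trans (count-∨ (λ y → ⌊ y ≟ x ⌋) (λ y → T y ∧ E x y)) (+-mono-≤ (count-≟ x) deg≤N))
    count-I : suc (count R.I) ≤ count I
    count-I = count-mono-< (λ y → ∨⁺ʳ) x (¬-not λ RIx → not-¬ (R.I⊆S x RIx) (remaining-self T x)) (∨⁺ˡ (⌊⌋⁺ (x ≟ x) refl))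
    open ≤-Reasoning
    large : count T ≤ suc N * count I
    large = begin
      count T                      ≡⟨ count-split T (λ y → ⌊ y ≟ x ⌋ ∨ E x y) ⟩
      count removed + count (remaining T x)     ≤⟨ +-mono-≤ count-removed R.large ⟩
      suc N + suc N * count R.I    ≡⟨ *-suc (suc N) (count R.I) ⟨
      suc N * suc (count R.I)      ≤⟨ *-monoʳ-≤ (suc N) count-I ⟩
      suc N * count I              ∎

  -- Greedy choice: a vertex of at most average degree goes into `I`, and with it at most `suc N`
  -- vertices leave `T`. The average has to be taken anew on what remains, hence a hypothesis on all
  -- subsets of `S`.
  independent : ∀ S → (∀ T → (∀ x → T x ≡ true → S x ≡ true) →
                  ∑∈ T (λ x → count (λ y → T y ∧ E x y)) ≤ N * count T) → Independent E N S
  independent S sparse = go (count S) S (λ _ Sx → Sx) ≤-refl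
    where
    go : ∀ fuel T → (∀ x → T x ≡ true → S x ≡ true) → count T ≤ fuel → Independent E N T
    go fuel T T⊆S le with 0 <? count T
    ... | no empty = record
      { I = λ _ → false ; I⊆S = λ _ () ; separated = λ _ _ ()
      ; large = ≤-trans (≮⇒≥ empty) z≤n }
    ... | yes nonempty with ∃-below-average T (λ x → count (λ y → T y ∧ E x y)) N nonempty (sparse T T⊆S)
    go zero T T⊆S le | yes nonempty | _ = ⊥-elim (<⇒≱ nonempty le)
    go (suc fuel) T T⊆S le | yes nonempty | x , Tx , deg≤N =
      independent-add T x Tx deg≤N (go fuel (remaining T x) (λ y → T⊆S y ∘ remaining-⊆ T x y)
        (s≤s⁻¹ (≤-trans (count-mono-< (remaining-⊆ T x) x (remaining-self T x) Tx) le)))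

-- Small hitting sets

module _ (G : Graph) where

  private
    V : Set
    V = Fin (n G)

  -- `A` is arbitrary so that the remainder of a walk above `s` is again above `s`, and the
  -- remainder is shorter by one so that `count-reach` can recurse. For `s` equal to `x` the walk
  -- may be trivial and need not meet `Z`.
  record HittingSet (m r : ℕ) (x : V) (S : V → Bool) : Set where
    field
      Z     : V → Bool
      small : count Z ≤ m
      hits  : ∀ {A i s} → S s ≡ true → s ≢ x → i ≤ r → WalkIn G A i x s →
              ∃[ z ] (Z z ≡ true × WalkIn G A (pred i) z s)

-- From right to left: the loss in passing from `S` to `I`, the used vertices per vertex of `S`, and
-- the density of the minor that contracts the balls.
hittingBound : ℕ → ℕ → ℕ
hittingBound r N = N * (suc (suc (r + r) * N) * suc N)

module _ {G : Graph} {r N : ℕ} (bound : MinorDensity G (r + r) N) (S : Fin (n G) → Bool) where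

  private
    V : Set
    V = Fin (n G)

  Cells : Set
  Cells = V → Maybe V

  cell : Cells → V → V → Bool
  cell own x w = ⌊ Maybe-≡-dec _≟_ (own w) (just x) ⌋

  cell⁺ : ∀ own {x w} → own w ≡ just x → cell own x w ≡ true
  cell⁺ own {x} {w} = ⌊⌋⁺ (Maybe-≡-dec _≟_ (own w) (just x))

  cell⁻ : ∀ own {x w} → cell own x w ≡ true → own w ≡ just x
  cell⁻ own {x} {w} = ⌊⌋⁻ (Maybe-≡-dec _≟_ (own w) (just x))

  used : Cells → V → Bool
  used own v = is-just (own v)

  used⁻ : ∀ own v → used own v ≡ true → ∃[ x ] own v ≡ just x
  used⁻ own v u with own v
  ... | just x = x , refl

  free : Cells → V → V → Bool
  free own x v = ⌊ v ≟ x ⌋ ∨ not (used own v)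

  links : Cells → ℕ
  links own = ∑∈ S (degIn G S (cell own))

  -- Every vertex of S owns a connected set of small radius; `owned-few` charges the owned vertices
  -- outside S to the pairs of touching cells.
  record System : Set where
    field
      own       : Cells
      self      : ∀ x → S x ≡ true → own x ≡ just x
      root      : ∀ {x w} → own w ≡ just x → S x ≡ true
      near      : ∀ {x w} → own w ≡ just x → WalkIn G (cell own x) (r + r) x w
      owned-few : count (used own) ≤ count S + suc (r + r) * links own

  open System

  system-branchSets : ∀ (sys : System) T → (∀ x → T x ≡ true → S x ≡ true) →
                      BranchSets G (r + r) T (cell (own sys))
  system-branchSets sys T T⊆S = record
    { centre   = λ x Tx → cell⁺ (own sys) (self sys x (T⊆S x Tx))
    ; radius   = λ x w _ ηw → near sys (cell⁻ (own sys) ηw)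
    ; disjoint = λ x y w _ _ ηx ηy → just-injective (trans (≡-sym (cell⁻ (own sys) ηx)) (cell⁻ (own sys) ηy))
    }

  links-bound : ∀ sys → links (own sys) ≤ N * count S
  links-bound sys = branchSets-density N bound (system-branchSets sys S (λ _ Sx → Sx))

  -- `r + r` bounds the length of a walk between the centres of two balls of radius `r` that meet.
  -- The last edge is split off because `y` belongs to its own cell, whereas everything up to `w`
  -- will join the cell of `x`.
  Linkable : Cells → V → V → Set
  Linkable own x y = S x ≡ true × S y ≡ true × x ≢ y × ¬ Touching G (cell own) x y
    × (∃[ w ] (WalkIn G (free own x) (r + r) x w × adj G w y ≡ true))

  linkable? : ∀ own x y → Dec (Linkable own x y)
  linkable? own x y = isTrue? (S x) ×-dec (isTrue? (S y) ×-dec (¬? (x ≟ y) ×-dec (¬? (touching? G (cell own) x y)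
    ×-dec any? (λ w → walk? G (free own x) (r + r) x w ×-dec isTrue? (adj G w y)))))

  emptySystem : System
  emptySystem = record { own = o ; self = o-self ; root = o-root ; near = o-near ; owned-few = few }
    where
    o : Cells
    o v = if S v then just v else nothing
    o-self : ∀ x → S x ≡ true → o x ≡ just x
    o-self x Sx rewrite Sx = refl
    inverse : ∀ {x w} → o w ≡ just x → w ≡ x × S w ≡ true
    inverse {x} {w} eq with S w
    inverse refl | true = refl , refl
    o-root : ∀ {x w} → o w ≡ just x → S x ≡ true
    o-root eq with inverse eq
    ... | refl , Sx = Sx
    o-near : ∀ {x w} → o w ≡ just x → WalkIn G (cell o x) (r + r) x w
    o-near eq with inverse eq
    ... | refl , Sx = here (cell⁺ o eq)
    few : count (used o) ≤ count S + suc (r + r) * links o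
    few = ≤-trans (count-mono λ v u → proj₂ (inverse (proj₂ (used⁻ o v u)))) (m≤m+n _ _)

  -- Apart from its start the walk lies in no cell, so handing it to `x` robs no other cell, and its
  -- prefixes start at `x`, so the radius stays `r + r`. At most `suc (r + r)` vertices become
  -- owned, and the new link pays for them.
  extend : (sys : System) → ∀ x y → Linkable (own sys) x y → ∃[ sys′ ] links (own sys) < links (own sys′)
  extend sys x y (Sx , Sy , x≢y , apart , w , p , e) = sys′ , more
    where
    o : Cells
    o v = if vertices p v then just x else own sys v
    on-walk : ∀ v → vertices p v ≡ true → o v ≡ just x
    on-walk v v∈p rewrite v∈p = refl
    own-on-walk : ∀ v → vertices p v ≡ true → ∀ {z} → own sys v ≡ just z → v ≡ x
    own-on-walk v v∈p eq with ∨⁻ ⌊ v ≟ x ⌋ (vertices-⊆ p v v∈p)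
    ... | inj₁ v≡x  = ⌊⌋⁻ (v ≟ x) v≡x
    ... | inj₂ free rewrite eq with () ← free
    extends : ∀ {v z} → own sys v ≡ just z → o v ≡ just z
    extends {v} eq with vertices p v in v∈p
    ... | false = eq
    ... | true with refl ← own-on-walk v v∈p eq = trans (≡-sym (self sys x Sx)) eq
    inverse : ∀ {v z} → o v ≡ just z → (vertices p v ≡ true × z ≡ x) ⊎ own sys v ≡ just z
    inverse {v} eq with vertices p v
    ... | true  = inj₁ (refl , ≡-sym (just-injective eq))
    ... | false = inj₂ eq
    o-root : ∀ {z v} → o v ≡ just z → S z ≡ true
    o-root eq with inverse eq
    ... | inj₁ (_ , refl) = Sx
    ... | inj₂ old        = root sys old
    cell-extends : ∀ z v → cell (own sys) z v ≡ true → cell o z v ≡ true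
    cell-extends z v = cell⁺ o ∘ extends ∘ cell⁻ (own sys)
    o-near : ∀ {z v} → o v ≡ just z → WalkIn G (cell o z) (r + r) z v
    o-near {z} {v} eq with inverse eq
    ... | inj₁ (v∈p , refl) = walk-⊆ (λ a → cell⁺ o ∘ on-walk a) (walk-prefix p v v∈p)
    ... | inj₂ old          = walk-⊆ (cell-extends z) (near sys old)
    touch-extends : ∀ a b → Touching G (cell (own sys)) a b → Touching G (cell o) a b
    touch-extends a b (a≢b , s , t , ηs , ηt , st) = a≢b , s , t , cell-extends a s ηs , cell-extends b t ηt , st
    adjacent-extends : ∀ a b → S b ∧ ⌊ touching? G (cell (own sys)) a b ⌋ ≡ true →
                       S b ∧ ⌊ touching? G (cell o) a b ⌋ ≡ true
    adjacent-extends a b eq with ∧⁻ (S b) eq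
    ... | Sb , t = ∧⁺ Sb (⌊⌋⁺ (touching? G (cell o) a b) (touch-extends a b (⌊⌋⁻ (touching? G (cell (own sys)) a b) t)))
    touch : Touching G (cell o) x y
    touch = x≢y , w , y , cell⁺ o (on-walk w (vertices-end p)) , cell⁺ o (extends (self sys y Sy)) , e
    more : links (own sys) < links o
    more = ∑∈-mono-< (λ a → count-mono (adjacent-extends a)) x Sx
      (count-mono-< (adjacent-extends x) y
        (¬-not λ eq → apart (⌊⌋⁻ (touching? G (cell (own sys)) x y) (proj₂ (∧⁻ (S y) eq))))
        (∧⁺ Sy (⌊⌋⁺ (touching? G (cell o) x y) touch)))
    used-split : ∀ v → used o v ≡ true → vertices p v ∨ used (own sys) v ≡ true
    used-split v u with vertices p v
    ... | true  = refl
    ... | false = u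
    open ≤-Reasoning
    few : count (used o) ≤ count S + suc (r + r) * links o
    few = begin
      count (used o)
        ≤⟨ count-mono used-split ⟩
      count (λ v → vertices p v ∨ used (own sys) v)
        ≤⟨ count-∨ (vertices p) (used (own sys)) ⟩
      count (vertices p) + count (used (own sys))
        ≤⟨ +-mono-≤ (count-vertices p) (owned-few sys) ⟩
      suc (r + r) + (count S + suc (r + r) * links (own sys))
        ≡⟨ rearrange (suc (r + r)) (count S) (links (own sys)) ⟩
      count S + suc (r + r) * suc (links (own sys))
        ≤⟨ +-monoʳ-≤ (count S) (*-monoʳ-≤ (suc (r + r)) more) ⟩
      count S + suc (r + r) * links o ∎
      where
      rearrange : ∀ a b c → a + (b + a * c) ≡ b + a * suc c
      rearrange = solve-∀
    sys′ : System
    sys′ = record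
      { own = o ; self = λ z Sz → extends (self sys z Sz) ; root = o-root ; near = o-near ; owned-few = few }

  -- The links come from a minor and number at most `N * count S`, while every extension adds at
  -- least one; by the invariant of `go`, running out of fuel contradicts `links-bound`.
  saturated : ∃[ sys ] (∀ x y → ¬ Linkable (own sys) x y)
  saturated = go (suc (N * count S)) emptySystem (m≤m+n _ _)
    where
    go : ∀ fuel sys → N * count S < fuel + links (own sys) → ∃[ sys ] (∀ x y → ¬ Linkable (own sys) x y)
    go zero sys lt = ⊥-elim (<⇒≱ lt (links-bound sys))
    go (suc fuel) sys lt with any? (λ x → any? (λ y → linkable? (own sys) x y))
    ... | no none = sys , λ x y l → none (x , y , l)
    ... | yes (x , y , l) with extend sys x y l
    ...   | sys′ , more = go fuel sys′
      (≤-trans lt (≤-trans (≤-reflexive (≡-sym (+-suc fuel _))) (+-monoʳ-≤ fuel more)))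

  touches : System → V → V → Bool
  touches sys x y = ⌊ touching? G (cell (own sys)) x y ⌋

  system-independent : ∀ sys → Independent (touches sys) N S
  system-independent sys = independent (touches sys)
    (λ x y → ⌊⌋⁺ (touching? G (cell (own sys)) y x) ∘ touching-sym G {cell (own sys)} ∘ ⌊⌋⁻ (touching? G (cell (own sys)) x y))
    N S (λ T T⊆S → branchSets-density N bound (system-branchSets sys T T⊆S))

  module _ (sys : System) (sat : ∀ x y → ¬ Linkable (own sys) x y) (ind : Independent (touches sys) N S)
           (nonempty : 0 < count S) where

    open Independent ind

    U : V → Bool
    U = used (own sys)

    S⊆U : ∀ x → S x ≡ true → U x ≡ true
    S⊆U x Sx rewrite self sys x Sx = refl

    ball : V → V → Bool
    ball x v = ⌊ walk? G (free (own sys) x) r x v ⌋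

    free-used : ∀ {x v} → free (own sys) x v ≡ true → U v ≡ true → v ≡ x
    free-used {x} {v} f u with ∨⁻ ⌊ v ≟ x ⌋ f
    ... | inj₁ v≡x = ⌊⌋⁻ (v ≟ x) v≡x
    ... | inj₂ ¬u  = ⊥-elim (not⁻ (U v) ¬u u)

    -- A walk that leaves the ball of x and reaches y would link x with y.
    reach : ∀ {x y w j k} → S x ≡ true → S y ≡ true → x ≢ y → ¬ Touching G (cell (own sys)) x y →
            j + k ≤ r + r → WalkIn G (free (own sys) x) j x w → ¬ WalkIn G (free (own sys) y) k w y
    reach Sx Sy x≢y apart le p (here _) = x≢y (≡-sym (free-used (walk-end p) (S⊆U _ Sy)))
    reach {x} {y} {w} {j} {suc k} Sx Sy x≢y apart le p (step {y = w′} _ e q) with ∨⁻ ⌊ w′ ≟ y ⌋ (walk-start q)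
    ... | inj₁ w′≡y with refl ← ⌊⌋⁻ (w′ ≟ y) w′≡y =
      sat x y (Sx , Sy , x≢y , apart , w , walk-≤ (≤-trans (m≤m+n j (suc k)) le) p , e)
    ... | inj₂ unused =
      reach Sx Sy x≢y apart (subst (_≤ r + r) (+-suc j k) le) (walk-snoc p e (∨⁺ʳ unused)) q

    -- Branch sets are indexed by all used vertices so that the degree of `x` bounds the number of
    -- other used vertices adjacent to its ball. Only members of `I` receive their ball, because for
    -- these saturation makes the balls disjoint.
    η : V → V → Bool
    η x v = ⌊ v ≟ x ⌋ ∨ (I x ∧ ball x v)

    η⁻ : ∀ {x v} → η x v ≡ true → v ≡ x ⊎ (I x ≡ true × WalkIn G (free (own sys) x) r x v)
    η⁻ {x} {v} eq with ∨⁻ ⌊ v ≟ x ⌋ eq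
    ... | inj₁ v≡x = inj₁ (⌊⌋⁻ (v ≟ x) v≡x)
    ... | inj₂ b with ∧⁻ (I x) b
    ...   | Ix , p = inj₂ (Ix , ⌊⌋⁻ (walk? G (free (own sys) x) r x v) p)

    η-radius : ∀ x w → U x ≡ true → η x w ≡ true → WalkIn G (η x) (r + r) x w
    η-radius x w _ ηw with η⁻ ηw
    ... | inj₁ refl     = here ηw
    ... | inj₂ (Ix , p) = walk-≤ (m≤m+n r r) (walk-⊆ (λ v b → ∨⁺ʳ (∧⁺ Ix b)) (walk-in-ball p))

    η-disjoint : ∀ x y w → U x ≡ true → U y ≡ true → η x w ≡ true → η y w ≡ true → x ≡ y
    η-disjoint x y w Ux Uy ηx ηy with η⁻ ηx | η⁻ ηy
    ... | inj₁ refl     | inj₁ refl     = refl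
    ... | inj₁ refl     | inj₂ (_ , q)  = free-used (walk-end q) Ux
    ... | inj₂ (_ , p)  | inj₁ refl     = ≡-sym (free-used (walk-end p) Uy)
    ... | inj₂ (Ix , p) | inj₂ (Iy , q) with x ≟ y
    ...   | yes x≡y = x≡y
    ...   | no x≢y  = ⊥-elim (reach (I⊆S x Ix) (I⊆S y Iy) x≢y
        (λ t → separated x y Ix Iy x≢y (⌊⌋⁺ (touching? G (cell (own sys)) x y) t)) ≤-refl p (walk-reverse q))

    η-branchSets : BranchSets G (r + r) U η
    η-branchSets = record
      { centre = λ x _ → ∨⁺ˡ (⌊⌋⁺ (x ≟ x) refl) ; radius = η-radius ; disjoint = η-disjoint }

    count-U : count U ≤ suc (suc (r + r) * N) * count S
    count-U = begin
      count U                                    ≤⟨ owned-few sys ⟩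
      count S + suc (r + r) * links (own sys)    ≤⟨ +-monoʳ-≤ (count S) (*-monoʳ-≤ (suc (r + r)) (links-bound sys)) ⟩
      count S + suc (r + r) * (N * count S)      ≡⟨ cong (count S +_) (*-assoc (suc (r + r)) N (count S)) ⟨
      suc (suc (r + r) * N) * count S            ∎
      where open ≤-Reasoning

    degrees : ∑∈ I (degIn G U η) ≤ hittingBound r N * count I
    degrees = begin
      ∑∈ I (degIn G U η)                              ≤⟨ ∑∈-mono-≤ (λ x → S⊆U x ∘ I⊆S x) (λ _ _ → ≤-refl) ⟩
      ∑∈ U (degIn G U η)                              ≤⟨ branchSets-density N bound η-branchSets ⟩
      N * count U                                     ≤⟨ *-monoʳ-≤ N count-U ⟩
      N * (c * count S)                               ≤⟨ *-monoʳ-≤ N (*-monoʳ-≤ c large) ⟩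
      N * (c * (suc N * count I))                     ≡⟨ rearrange N c (suc N) (count I) ⟩
      hittingBound r N * count I                      ∎
      where
      open ≤-Reasoning
      c : ℕ
      c = suc (suc (r + r) * N)
      rearrange : ∀ a b c d → a * (b * (c * d)) ≡ a * (b * c) * d
      rearrange = solve-∀

    I-nonempty : 0 < count I
    I-nonempty with count I in eq
    ... | suc _ = s≤s z≤n
    ... | zero  = ⊥-elim (<⇒≱ nonempty (≤-trans large (≤-reflexive (trans (cong (suc N *_) eq) (*-zeroʳ (suc N))))))

    hittingSet-saturated : ∃[ x ] (S x ≡ true × HittingSet G (hittingBound r N) r x S)
    hittingSet-saturated with ∃-below-average I (degIn G U η) (hittingBound r N) I-nonempty degrees
    ... | x , Ix , deg≤ = x , I⊆S x Ix , record
      { Z = Z ; small = deg≤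
      ; hits = λ Ss s≢x i≤r p → follow Ss s≢x i≤r (here (∨⁺ˡ (⌊⌋⁺ (x ≟ x) refl))) p }
      where
      Z : V → Bool
      Z y = U y ∧ ⌊ touching? G η x y ⌋
      -- `w` is the current position, still in the ball of `x` as `j + i ≤ r`. The walk ends at a
      -- vertex of `S` other than `x`, which is not free, so some step leaves the free vertices; the
      -- first such step lands on a used vertex adjacent to the ball.
      follow : ∀ {A i j w s} → S s ≡ true → s ≢ x → j + i ≤ r → WalkIn G (free (own sys) x) j x w →
               WalkIn G A i w s → ∃[ z ] (Z z ≡ true × WalkIn G A (pred i) z s)
      follow Ss s≢x le p (here _) = ⊥-elim (s≢x (free-used (walk-end p) (S⊆U _ Ss)))
      follow {i = suc i} {j} {w} Ss s≢x le p (step {y = w′} _ e q) with isTrue? (free (own sys) x w′)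
      ... | yes f with follow Ss s≢x (subst (_≤ r) (+-suc j i) le) (walk-snoc p e f) q
      ...   | z , Zz , q′ = z , Zz , walk-≤ pred[n]≤n q′
      follow {i = suc i} {j} {w} Ss s≢x le p (step {y = w′} _ e q) | no ¬f = w′ , ∧⁺ Uw′ (⌊⌋⁺ (touching? G η x w′) touch) , q
        where
        Uw′ : U w′ ≡ true
        Uw′ with isTrue? (U w′)
        ... | yes u = u
        ... | no ¬u = ⊥-elim (¬f (∨⁺ʳ (not⁺ ¬u)))
        touch : Touching G η x w′
        touch = (λ x≡w′ → ¬f (∨⁺ˡ (⌊⌋⁺ (w′ ≟ x) (≡-sym x≡w′)))) , w , w′
          , ∨⁺ʳ (∧⁺ Ix (⌊⌋⁺ (walk? G (free (own sys) x) r x w) (walk-≤ (≤-trans (m≤m+n j (suc i)) le) p)))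
          , ∨⁺ˡ (⌊⌋⁺ (w′ ≟ w′) refl) , e

  hittingSet : 0 < count S → ∃[ x ] (S x ≡ true × HittingSet G (hittingBound r N) r x S)
  hittingSet = let sys , sat = saturated in hittingSet-saturated sys sat (system-independent sys)

-- Orders with bounded weak reachability

≤ᵇ⁺ : ∀ {i j} → i ≤ j → (i ≤ᵇ j) ≡ true
≤ᵇ⁺ {i} {j} i≤j with i ≤ᵇ j | ≤⇒≤ᵇ i≤j
... | true | _ = refl

≤ᵇ⁻ : ∀ {i j} → (i ≤ᵇ j) ≡ true → i ≤ j
≤ᵇ⁻ {i} {j} eq = ≤ᵇ⇒≤ i j (subst T (≡-sym eq) _)

-- `pos-<` reserves position `count S` for a vertex put on top. In `hitting` the vertices up to `x`
-- are those still unplaced when the construction picks `x`, itself included.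
record Ordering (G : Graph) (m r : ℕ) (S : Fin (n G) → Bool) : Set where
  field
    pos           : Fin (n G) → ℕ
    pos-<         : ∀ x → S x ≡ true → pos x < count S
    pos-injective : ∀ x y → S x ≡ true → S y ≡ true → pos x ≡ pos y → x ≡ y
    hitting       : ∀ x → S x ≡ true → HittingSet G m r x (λ s → S s ∧ (pos s ≤ᵇ pos x))

_∖_ : ∀ {k} → (Fin k → Bool) → Fin k → Fin k → Bool
(S ∖ x) y = S y ∧ not ⌊ y ≟ x ⌋

∖⁺ : ∀ {k} {S : Fin k → Bool} {x} y → S y ≡ true → y ≢ x → (S ∖ x) y ≡ true
∖⁺ {x = x} y Sy y≢x = ∧⁺ Sy (not⁺ (y≢x ∘ ⌊⌋⁻ (y ≟ x)))

count-∖ : ∀ {l} (S : Fin l → Bool) x → S x ≡ true → count S ≡ suc (count (S ∖ x))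
count-∖ S x Sx = trans (count-split S (λ y → ⌊ y ≟ x ⌋)) (cong (_+ count (S ∖ x)) one)
  where
  one : count (λ y → S y ∧ ⌊ y ≟ x ⌋) ≡ 1
  one = ≤-antisym (≤-trans (count-mono (λ y → proj₂ ∘ ∧⁻ (S y))) (count-≟ x))
                  (count-pos {p = λ y → S y ∧ ⌊ y ≟ x ⌋} x (∧⁺ Sx (⌊⌋⁺ (x ≟ x) refl)))

-- `x` takes the highest position, so its own hitting set has to deal with all of `S`. For any other
-- `y` the vertices up to `y` are the same as before, and its hitting set is kept.
ordering-add : ∀ {G m r} S x → S x ≡ true → HittingSet G m r x S → Ordering G m r (S ∖ x) → Ordering G m r S
ordering-add {G} {m} {r} S x Sx hit ord =
  record { pos = pos ; pos-< = pos-< ; pos-injective = pos-injective ; hitting = hitting }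
  where
  k : ℕ
  k = count (S ∖ x)
  module O = Ordering ord
  pos : Fin (n G) → ℕ
  pos y = if ⌊ y ≟ x ⌋ then k else O.pos y
  pos-x : pos x ≡ k
  pos-x rewrite ⌊⌋⁺ (x ≟ x) refl = refl
  pos-other : ∀ {y} → y ≢ x → pos y ≡ O.pos y
  pos-other {y} y≢x rewrite ⌊⌋-false (y ≟ x) y≢x = refl
  other-< : ∀ y → S y ≡ true → y ≢ x → pos y < k
  other-< y Sy y≢x = ≤-trans (≤-reflexive (cong suc (pos-other y≢x)))
    (O.pos-< y (∖⁺ {S = S} y Sy y≢x))
  pos-< : ∀ y → S y ≡ true → pos y < count S
  pos-< y Sy rewrite count-∖ S x Sx with y ≟ x
  ... | yes refl = ≤-refl
  ... | no y≢x   = m<n⇒m<1+n (O.pos-< y (∖⁺ {S = S} y Sy y≢x))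
  pos-injective : ∀ y z → S y ≡ true → S z ≡ true → pos y ≡ pos z → y ≡ z
  pos-injective y z Sy Sz eq = cases (y ≟ x) (z ≟ x)
    where
    cases : Dec (y ≡ x) → Dec (z ≡ x) → y ≡ z
    cases (yes refl) (yes refl) = refl
    cases (yes refl) (no z≢x)   = ⊥-elim (<⇒≢ (other-< z Sz z≢x) (trans (≡-sym eq) pos-x))
    cases (no y≢x)   (yes refl) = ⊥-elim (<⇒≢ (other-< y Sy y≢x) (trans eq pos-x))
    cases (no y≢x)   (no z≢x)   = O.pos-injective y z (∖⁺ {S = S} y Sy y≢x) (∖⁺ {S = S} z Sz z≢x)
      (trans (≡-sym (pos-other y≢x)) (trans eq (pos-other z≢x)))
  hitting : ∀ y → S y ≡ true → HittingSet G (m) r y (λ s → S s ∧ (pos s ≤ᵇ pos y))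
  hitting y Sy = cases (y ≟ x)
    where
    cases : Dec (y ≡ x) → HittingSet G (m) r y (λ s → S s ∧ (pos s ≤ᵇ pos y))
    cases (yes refl) = record
      { Z = Z ; small = small ; hits = λ {A} {i} {s} Ts → hits (proj₁ (∧⁻ (S s) Ts)) }
      where open HittingSet hit
    cases (no y≢x) = record { Z = Z ; small = small ; hits = λ {A} {i} {s} Ts → hits (below s Ts) }
      where
      open HittingSet (O.hitting y (∖⁺ {S = S} y Sy y≢x))
      below : ∀ s → S s ∧ (pos s ≤ᵇ pos y) ≡ true → (S ∖ x) s ∧ (O.pos s ≤ᵇ O.pos y) ≡ true
      below s Ts with ∧⁻ (S s) Ts
      ... | Ss , le = ∧⁺ (∖⁺ {S = S} s Ss s≢x) (≤ᵇ⁺ (subst₂ _≤_ (pos-other s≢x) (pos-other y≢x) (≤ᵇ⁻ le)))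
        where
        s≢x : s ≢ x
        s≢x refl = <⇒≱ (other-< y Sy y≢x) (≤-trans (≤-reflexive (≡-sym pos-x)) (≤ᵇ⁻ le))

ordering : ∀ {G r N} → MinorDensity G (r + r) N → ∀ k S → count S ≡ k → Ordering G (hittingBound r N) r S
ordering bound zero S empty = record
  { pos = λ _ → 0
  ; pos-< = λ x Sx → ⊥-elim (nobody x Sx)
  ; pos-injective = λ x _ Sx → ⊥-elim (nobody x Sx)
  ; hitting = λ x Sx → ⊥-elim (nobody x Sx) }
  where
  nobody : ∀ x → ¬ S x ≡ true
  nobody x Sx = <⇒≱ (count-pos {p = S} x Sx) (≤-reflexive empty)
ordering {G} {r} {N} bound (suc k) S size =
  let x , Sx , hit = hittingSet {G} {r} {N} bound S (≤-trans (s≤s z≤n) (≤-reflexive (≡-sym size))) in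
  ordering-add S x Sx hit (ordering {G} {r} {N} bound k (S ∖ x) (cong pred (trans (≡-sym (count-∖ S x Sx)) size)))

module WeakReach (G : Graph) (pos : Fin (n G) → ℕ) where

  private
    V : Set
    V = Fin (n G)

  above : V → V → Bool
  above s w = pos s ≤ᵇ pos w

  -- Weak `i`-reachability: `s` is a lowest vertex of the walk from `v`.
  Reach : ℕ → V → V → Set
  Reach i v s = WalkIn G (above s) i v s

  reach? : ∀ i v s → Dec (Reach i v s)
  reach? i v s = walk? G (above s) i v s

  walk-above : ∀ {s t k x z} → pos s ≤ pos t → WalkIn G (above t) k x z → WalkIn G (above s) k x z
  walk-above s≤t = walk-⊆ (λ w → ≤ᵇ⁺ ∘ ≤-trans s≤t ∘ ≤ᵇ⁻)

  reach-pos : ∀ {i v s} → Reach i v s → pos s ≤ pos v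
  reach-pos p = ≤ᵇ⁻ (walk-start p)

  reach-refl : ∀ {i v} → Reach i v v
  reach-refl {v = v} = here (≤ᵇ⁺ (≤-refl {pos v}))

  -- Induction along the walk. If the new start `u` is lower than the lowest vertex of the rest, the
  -- two halves are glued together again and `u` takes over.
  lowest : ∀ {A k u v} → WalkIn G A k u v →
           ∃[ a ] ∃[ i ] ∃[ j ] (i + j ≤ k × Reach i u a × WalkIn G (above a) j a v)
  lowest {u = u} (here _) = u , 0 , 0 , z≤n , reach-refl , reach-refl
  lowest {k = suc k} {u} (step _ e p) with lowest p
  ... | a , i , j , le , q , q′ with pos a ≤? pos u
  ...   | yes a≤u = a , suc i , j , s≤s le , step (≤ᵇ⁺ a≤u) e q , q′
  ...   | no a≰u  = u , 0 , suc k , ≤-refl , reach-refl , step (≤ᵇ⁺ (≤-refl {pos u})) e (walk-≤ le (walk-++ (up q) (up q′)))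
    where
    up : ∀ {k x z} → WalkIn G (above a) k x z → WalkIn G (above u) k x z
    up = walk-above (<⇒≤ (≰⇒> a≰u))

reachBound : ℕ → ℕ → ℕ
reachBound m zero    = 1
reachBound m (suc i) = suc (m * reachBound m i)

module _ {G : Graph} {m r : ℕ} (ord : Ordering G m r (λ _ → true)) where

  open Ordering ord
  open WeakReach G pos

  private
    V : Set
    V = Fin (n G)

  -- Every `s` other than `v` is reached from a member of the hitting set of `v` by a shorter walk
  -- that is still above `s`. This gives one plus `m` times the bound for `i`.
  count-reach : ∀ i → i ≤ r → ∀ v → count (λ s → ⌊ reach? i v s ⌋) ≤ reachBound m i
  count-reach zero _ v = ≤-trans (count-mono trivial) (count-≟ v)
    where
    trivial : ∀ s → ⌊ reach? 0 v s ⌋ ≡ true → ⌊ s ≟ v ⌋ ≡ true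
    trivial s eq with ⌊⌋⁻ (reach? 0 v s) eq
    ... | here _ = ⌊⌋⁺ (s ≟ s) refl
  count-reach (suc i) i<r v = begin
    count (λ s → ⌊ reach? (suc i) v s ⌋)
      ≤⟨ count-mono split ⟩
    count (λ s → ⌊ s ≟ v ⌋ ∨ far s)
      ≤⟨ count-∨ (λ s → ⌊ s ≟ v ⌋) far ⟩
    count (λ s → ⌊ s ≟ v ⌋) + count far
      ≤⟨ +-mono-≤ (count-≟ v) (count-⋃ (λ z s → ⌊ reach? i z s ⌋) hit) ⟩
    suc (∑∈ Z (λ z → count (λ s → ⌊ reach? i z s ⌋)))
      ≤⟨ s≤s (∑∈-≤-const {S = Z} (λ z _ → count-reach i (<⇒≤ i<r) z)) ⟩
    suc (count Z * reachBound m i)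
      ≤⟨ s≤s (*-monoˡ-≤ (reachBound m i) small) ⟩
    reachBound m (suc i) ∎
    where
    open ≤-Reasoning
    open HittingSet (hitting v refl)
    far : V → Bool
    far s = not ⌊ s ≟ v ⌋ ∧ ⌊ reach? (suc i) v s ⌋
    split : ∀ s → ⌊ reach? (suc i) v s ⌋ ≡ true → ⌊ s ≟ v ⌋ ∨ far s ≡ true
    split s eq with ⌊ s ≟ v ⌋
    ... | true  = refl
    ... | false = eq
    hit : ∀ s → far s ≡ true → ∃[ z ] (Z z ≡ true × ⌊ reach? i z s ⌋ ≡ true)
    hit s eq with ∧⁻ (not ⌊ s ≟ v ⌋) eq
    ... | s≢v , walk with ⌊⌋⁻ (reach? (suc i) v s) walk
    ...   | p with hits (walk-start p) (not⁻ ⌊ s ≟ v ⌋ s≢v ∘ ⌊⌋⁺ (s ≟ v)) i<r p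
    ...     | z , Zz , q = z , Zz , ⌊⌋⁺ (reach? i z s) q

-- Labels that separate weakly reachable vertices

missing-value : ∀ {k K} (P : Fin k → Bool) (f : Fin k → Fin (suc K)) → count P ≤ K →
                ∃[ j ] (∀ s → P s ≡ true → f s ≢ j)
missing-value {k} {K} P f le with any? (λ j → ¬? (any? (λ s → isTrue? (P s) ×-dec (f s ≟ j))))
... | yes (j , miss) = j , λ s Ps fs≡j → miss (s , Ps , fs≡j)
... | no none = ⊥-elim (<⇒≱ (s≤s le) (begin
    suc K                                       ≡⟨ count-all {suc K} ⟨
    count {suc K} (λ _ → true)                  ≤⟨ count-⋃ {P = λ _ → true} (λ s j → ⌊ f s ≟ j ⌋) (λ j _ → onto j) ⟩
    ∑∈ P (λ s → count (λ j → ⌊ f s ≟ j ⌋))      ≤⟨ ∑∈-≤-const {S = P} (λ s _ → one s) ⟩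
    count P * 1                                 ≡⟨ *-identityʳ (count P) ⟩
    count P                                     ∎))
  where
  open ≤-Reasoning
  one : ∀ s → count (λ j → ⌊ f s ≟ j ⌋) ≤ 1
  one s = ≤-trans (count-mono (λ j eq → ⌊⌋⁺ (j ≟ f s) (≡-sym (⌊⌋⁻ (f s ≟ j) eq)))) (count-≟ (f s))
  onto : ∀ j → ∃[ s ] (P s ≡ true × ⌊ f s ≟ j ⌋ ≡ true)
  onto j with any? (λ s → isTrue? (P s) ×-dec (f s ≟ j))
  ... | yes (s , Ps , fs≡j) = s , Ps , ⌊⌋⁺ (f s ≟ j) fs≡j
  ... | no  miss            = ⊥-elim (none (j , miss))

-- Greedy labelling by increasing position. The vertices weakly reached from `x` are at or below it
-- and at most `K` in number, so one of `suc K` labels is left for `x`; lower vertices never reach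
-- `x`, so relabelling it does them no harm.
reach-colouring : ∀ {G m r K} (ord : Ordering G m r (λ _ → true)) → let open WeakReach G (Ordering.pos ord) in
                  (∀ v → count (λ s → ⌊ reach? r v s ⌋) ≤ K) →
                  ∃[ lab ] (∀ v s → v ≢ s → Reach r v s → lab v ≢ (Fin (suc K) ∋ lab s))
reach-colouring {G} {m} {r} {K} ord small with go (n G)
  where
  open Ordering ord
  open WeakReach G pos
  go : ∀ k → ∃[ lab ] (∀ v s → pos v < k → v ≢ s → Reach r v s → lab v ≢ (Fin (suc K) ∋ lab s))
  go zero = (λ _ → zero) , λ _ _ ()
  go (suc k) with go k | any? (λ v → pos v ≟ℕ k)
  ... | lab , ok | no none = lab , λ v s v<1+k → ok v s (≤∧≢⇒< (s≤s⁻¹ v<1+k) (λ eq → none (v , eq)))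
  ... | lab , ok | yes (x , refl) with missing-value (λ s → ⌊ reach? r x s ⌋) lab (small x)
  ...   | j , new = lab′ , ok′
    where
    lab′ : Fin (n G) → Fin (suc K)
    lab′ v = if ⌊ v ≟ x ⌋ then j else lab v
    lab′-other : ∀ {v} → v ≢ x → lab′ v ≡ lab v
    lab′-other {v} v≢x rewrite ⌊⌋-false (v ≟ x) v≢x = refl
    ok′ : ∀ v s → pos v < suc (pos x) → v ≢ s → Reach r v s → lab′ v ≢ lab′ s
    ok′ v s v≤x v≢s p eq with v ≟ x
    ... | yes refl = new s (⌊⌋⁺ (reach? r x s) p)
      (trans (≡-sym (lab′-other (v≢s ∘ ≡-sym))) (≡-sym eq))
    ... | no v≢x = ok v s v<x v≢s p (trans eq (lab′-other s≢x))
      where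
      v<x : pos v < pos x
      v<x = ≤∧≢⇒< (s≤s⁻¹ v≤x) (v≢x ∘ pos-injective v x refl refl)
      s≢x : s ≢ x
      s≢x refl = <⇒≱ v<x (reach-pos p)
... | lab , ok = lab , λ v s → ok v s (≤-trans (Ordering.pos-< ord v refl) (≤-reflexive count-all))

-- Parity refinements of colourings

even⊎odd : ∀ a → a % 2 ≡ 0 ⊎ a % 2 ≡ 1
even⊎odd a with a % 2 | m%n<n a 2
... | 0 | _ = inj₁ refl
... | 1 | _ = inj₂ refl
... | suc (suc _) | s≤s (s≤s ())

odd-complement : ∀ a b → a % 2 ≡ 1 → (a + b) % 2 ≡ 0 → b % 2 ≡ 1
odd-complement a b odd-a even with even⊎odd b
... | inj₂ odd-b  = odd-b
... | inj₁ even-b with () ← trans (≡-sym even)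
        (trans (%-distribˡ-+ a b 2) (cong₂ (λ s t → (s + t) % 2) odd-a even-b))

-- `meets-odd` picks a smallest level without deciding whether `Meets` holds there, and so ends in a
-- double negation, which is removed here.
zeroOrOdd-stable : ∀ k → ¬ ¬ ZeroOrOdd k → ZeroOrOdd k
zeroOrOdd-stable zero    _  = inj₁ refl
zeroOrOdd-stable (suc k) nn with even⊎odd (suc k)
... | inj₂ odd  = inj₂ odd
... | inj₁ even = ⊥-elim (nn λ { (inj₂ odd) → 0≢1+n (trans (≡-sym even) odd) })

zeroOrOdd-pos : ∀ {k} → 0 < k → ZeroOrOdd k → k % 2 ≡ 1
zeroOrOdd-pos 0<k (inj₁ refl) with () ← 0<k
zeroOrOdd-pos _   (inj₂ odd)  = odd

find : ∀ {k} → (Fin k → Bool) → Maybe (Fin k)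
find {zero}  p = nothing
find {suc k} p = if p zero then just zero else map suc (find (p ∘ suc))

find-sound : ∀ {k} (p : Fin k → Bool) {x} → find p ≡ just x → p x ≡ true
find-sound {suc k} p eq with p zero in p0
find-sound {suc k} p refl | true = p0
... | false with find (p ∘ suc) in found
find-sound {suc k} p refl | false | just y = find-sound (p ∘ suc) found

find-complete : ∀ {k} (p : Fin k → Bool) x → p x ≡ true → ∃[ y ] find p ≡ just y
find-complete {suc k} p x px with p zero in p0
... | true = zero , refl
find-complete {suc k} p zero    px | false with () ← trans (≡-sym px) p0
find-complete {suc k} p (suc x) px | false with find-complete (p ∘ suc) x px
... | y , found rewrite found = suc y , refl

bit : Bool → Fin 2
bit false = zero
bit true  = suc zero

bit-injective : ∀ {a b} → bit a ≡ bit b → a ≡ b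
bit-injective {false} {false} _ = refl
bit-injective {true}  {true}  _ = refl

bit-surjective : ∀ i → ∃[ b ] bit b ≡ i
bit-surjective zero       = false , refl
bit-surjective (suc zero) = true , refl

palette : ℕ → ℕ → ℕ
palette c zero    = c
palette c (suc t) = palette (c * 2) t

module _ {l : ℕ} where

  classSize : ∀ {c} {X : Set} → DecidableEquality X → (Fin l → Fin c) → (Fin l → X) → Fin c → X → ℕ
  classSize _≟X_ χ key i a = count (λ v → ⌊ χ v ≟ i ⌋ ∧ ⌊ key v ≟X a ⌋)

  OddClasses : ∀ {c} {X : Set} → DecidableEquality X → (Fin l → Fin c) → (Fin l → X) → Set
  OddClasses _≟X_ χ key = ∀ i a → ZeroOrOdd (classSize _≟X_ χ key i a)

  classSize-cong : ∀ {c c′} {X : Set} (_≟X_ : DecidableEquality X) {χ : Fin l → Fin c} {χ′ : Fin l → Fin c′} {key i j a} →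
                   (∀ v → key v ≡ a → χ v ≡ i → χ′ v ≡ j) → (∀ v → key v ≡ a → χ′ v ≡ j → χ v ≡ i) →
                   classSize _≟X_ χ key i a ≡ classSize _≟X_ χ′ key j a
  classSize-cong _≟X_ {χ} {χ′} {key} {i} {j} {a} to from = count-cong (transfer χ χ′ to) (transfer χ′ χ from)
    where
    transfer : ∀ {c c′} (χ : Fin l → Fin c) (χ′ : Fin l → Fin c′) {i j} → (∀ v → key v ≡ a → χ v ≡ i → χ′ v ≡ j) →
               ∀ v → ⌊ χ v ≟ i ⌋ ∧ ⌊ key v ≟X a ⌋ ≡ true → ⌊ χ′ v ≟ j ⌋ ∧ ⌊ key v ≟X a ⌋ ≡ true
    transfer χ χ′ {i} {j} f v eq with ∧⁻ ⌊ χ v ≟ i ⌋ eq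
    ... | χv , kv = ∧⁺ (⌊⌋⁺ (χ′ v ≟ j) (f v (⌊⌋⁻ (key v ≟X a) kv) (⌊⌋⁻ (χ v ≟ i) χv))) kv

  module Split {c : ℕ} {X Y : Set} (_≟X_ : DecidableEquality X) (_≟Y_ : DecidableEquality Y)
               (χ : Fin l → Fin c) (fine : Fin l → X) (coarse : Fin l → Y)
               (coarser : ∀ v w → fine v ≡ fine w → coarse v ≡ coarse w) (odd : OddClasses _≟X_ χ fine) where

    leader : Fin c → Y → Maybe X
    leader i a = map fine (find (λ v → ⌊ χ v ≟ i ⌋ ∧ ⌊ coarse v ≟Y a ⌋))

    -- The fine class of the leader is recoloured exactly when its coarse class is even; both halves are then odd.
    side : Fin c → Y → X → Bool
    side i a x with even⊎odd (classSize _≟Y_ χ coarse i a)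
    ... | inj₁ _ = ⌊ Maybe-≡-dec _≟X_ (leader i a) (just x) ⌋
    ... | inj₂ _ = false

    split : Fin l → Fin (c * 2)
    split v = combine (χ v) (bit (side (χ v) (coarse v) (fine v)))

    split-refines : ∀ v w → split v ≡ split w → χ v ≡ χ w
    split-refines v w = combine-injectiveˡ (χ v) _ (χ w) _

    -- `side` looks only at the fine class, so splitting never cuts a class of equal old colour and
    -- equal `fine`; parities reached on finer levels survive.
    split-constant : ∀ v w → χ v ≡ χ w → fine v ≡ fine w → split v ≡ split w
    split-constant v w χ≡ fine≡ rewrite χ≡ | coarser v w fine≡ | fine≡ = refl

    part : Fin c → Y → Bool → Fin l → Bool
    part i a b v = (⌊ χ v ≟ i ⌋ ∧ ⌊ coarse v ≟Y a ⌋) ∧ (if b then side i a (fine v) else not (side i a (fine v)))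

    -- If the coarse class is odd, it stays whole on the false side. If it is even and nonempty, the
    -- leader's fine class within colour `i` lies wholly inside it by `coarser` and is odd, and an
    -- even number minus an odd one is odd.
    part-odd : ∀ i a b → ZeroOrOdd (count (part i a b))
    part-odd i a b with even⊎odd (classSize _≟Y_ χ coarse i a)
    part-odd i a true  | inj₂ _ = inj₁ (count-none λ v eq → not-¬ (proj₂ (∧⁻ (⌊ χ v ≟ i ⌋ ∧ ⌊ coarse v ≟Y a ⌋) eq)) refl)
    part-odd i a false | inj₂ o = inj₂ (trans (cong (_% 2) (≡-sym (count-cong
      (λ v eq → ∧⁺ eq refl) (λ v → proj₁ ∘ ∧⁻ (⌊ χ v ≟ i ⌋ ∧ ⌊ coarse v ≟Y a ⌋))))) o)
    ... | inj₁ even with find (λ v → ⌊ χ v ≟ i ⌋ ∧ ⌊ coarse v ≟Y a ⌋) in found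
    ...   | nothing = inj₁ (count-none λ v eq → absurd v (proj₁ (∧⁻ (⌊ χ v ≟ i ⌋ ∧ ⌊ coarse v ≟Y a ⌋) eq)))
      where
      absurd : ∀ v → ¬ (⌊ χ v ≟ i ⌋ ∧ ⌊ coarse v ≟Y a ⌋ ≡ true)
      absurd v eq with find-complete (λ v → ⌊ χ v ≟ i ⌋ ∧ ⌊ coarse v ≟Y a ⌋) v eq
      ... | _ , found′ with () ← trans (≡-sym found) found′
    ...   | just x = both b
      where
      inClass : Fin l → Bool
      inClass v = ⌊ χ v ≟ i ⌋ ∧ ⌊ coarse v ≟Y a ⌋
      sameAsLeader : Fin l → Bool
      sameAsLeader v = ⌊ Maybe-≡-dec _≟X_ (just (fine x)) (just (fine v)) ⌋
      x∈class : χ x ≡ i × coarse x ≡ a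
      x∈class with ∧⁻ ⌊ χ x ≟ i ⌋ (find-sound inClass found)
      ... | χx , cx = ⌊⌋⁻ (χ x ≟ i) χx , ⌊⌋⁻ (coarse x ≟Y a) cx
      leader-class : count (λ v → inClass v ∧ sameAsLeader v) ≡ classSize _≟X_ χ fine i (fine x)
      leader-class = count-cong to from
        where
        to : ∀ v → inClass v ∧ sameAsLeader v ≡ true → ⌊ χ v ≟ i ⌋ ∧ ⌊ fine v ≟X fine x ⌋ ≡ true
        to v eq with ∧⁻ (inClass v) eq
        ... | cl , same = ∧⁺ (proj₁ (∧⁻ ⌊ χ v ≟ i ⌋ cl)) (⌊⌋⁺ (fine v ≟X fine x)
              (≡-sym (just-injective (⌊⌋⁻ (Maybe-≡-dec _≟X_ (just (fine x)) (just (fine v))) same))))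
        from : ∀ v → ⌊ χ v ≟ i ⌋ ∧ ⌊ fine v ≟X fine x ⌋ ≡ true → inClass v ∧ sameAsLeader v ≡ true
        from v eq with ∧⁻ ⌊ χ v ≟ i ⌋ eq
        ... | χv , fv with ⌊⌋⁻ (fine v ≟X fine x) fv
        ...   | f≡ = ∧⁺ (∧⁺ χv (⌊⌋⁺ (coarse v ≟Y a) (trans (coarser v x f≡) (proj₂ x∈class))))
                        (⌊⌋⁺ (Maybe-≡-dec _≟X_ (just (fine x)) (just (fine v))) (cong just (≡-sym f≡)))
      leader-odd : count (λ v → inClass v ∧ sameAsLeader v) % 2 ≡ 1
      leader-odd = trans (cong (_% 2) leader-class) (zeroOrOdd-pos
        (count-pos {p = λ v → ⌊ χ v ≟ i ⌋ ∧ ⌊ fine v ≟X fine x ⌋} x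
          (∧⁺ (⌊⌋⁺ (χ x ≟ i) (proj₁ x∈class)) (⌊⌋⁺ (fine x ≟X fine x) refl)))
        (odd i (fine x)))
      both : ∀ b → ZeroOrOdd (count (λ v → inClass v ∧ (if b then sameAsLeader v else not (sameAsLeader v))))
      both true  = inj₂ leader-odd
      both false = inj₂ (odd-complement (count (λ v → inClass v ∧ sameAsLeader v)) _ leader-odd
        (trans (cong (_% 2) (≡-sym (count-split inClass sameAsLeader))) even))

    if-bit : ∀ {s} b → s ≡ b → (if b then s else not s) ≡ true
    if-bit true  refl = refl
    if-bit false refl = refl

    if-bit⁻ : ∀ {s} b → (if b then s else not s) ≡ true → s ≡ b
    if-bit⁻ true eq          = eq
    if-bit⁻ {false} false eq = refl

    split-odd : OddClasses _≟Y_ split coarse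
    split-odd k a with combine-surjective {c} {2} k
    ... | i , j , refl with bit-surjective j
    ...   | b , refl = subst ZeroOrOdd (count-cong to from) (part-odd i a b)
      where
      to : ∀ v → part i a b v ≡ true → ⌊ split v ≟ combine i (bit b) ⌋ ∧ ⌊ coarse v ≟Y a ⌋ ≡ true
      to v eq with ∧⁻ (⌊ χ v ≟ i ⌋ ∧ ⌊ coarse v ≟Y a ⌋) eq
      ... | cl , s with ∧⁻ ⌊ χ v ≟ i ⌋ cl
      ...   | χv , cv = ∧⁺ (⌊⌋⁺ (split v ≟ combine i (bit b)) split≡) cv
        where
        split≡ : split v ≡ combine i (bit b)
        split≡ rewrite ⌊⌋⁻ (χ v ≟ i) χv | ⌊⌋⁻ (coarse v ≟Y a) cv = cong (combine i ∘ bit) (if-bit⁻ b s)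
      from : ∀ v → ⌊ split v ≟ combine i (bit b) ⌋ ∧ ⌊ coarse v ≟Y a ⌋ ≡ true → part i a b v ≡ true
      from v eq with ∧⁻ ⌊ split v ≟ combine i (bit b) ⌋ eq
      ... | sv , cv with combine-injective (χ v) _ i (bit b) (⌊⌋⁻ (split v ≟ combine i (bit b)) sv)
      ...   | χ≡ , s≡ = ∧⁺ (∧⁺ (⌊⌋⁺ (χ v ≟ i) χ≡) cv) (if-bit b side≡)
        where
        side≡ : side i a (fine v) ≡ b
        side≡ = trans (cong₂ (λ s t → side s t (fine v)) (≡-sym χ≡) (≡-sym (⌊⌋⁻ (coarse v ≟Y a) cv))) (bit-injective s≡)

  module _ {X : Set} (_≟X_ : DecidableEquality X) (key : ℕ → Fin l → X)
           (coarser : ∀ t v w → key (suc t) v ≡ key (suc t) w → key t v ≡ key t w) where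

    record Refinement {c} (χ : Fin l → Fin c) (T : ℕ) : Set where
      field
        χ′       : Fin l → Fin (palette c T)
        refines  : ∀ v w → χ′ v ≡ χ′ w → χ v ≡ χ w
        constant : ∀ v w → χ v ≡ χ w → key T v ≡ key T w → χ′ v ≡ χ′ w
        odd      : ∀ t → t ≤ T → OddClasses _≟X_ χ′ (key t)

    refine : ∀ T {c} (χ : Fin l → Fin c) → OddClasses _≟X_ χ (key T) → Refinement χ T
    refine zero χ odd = record
      { χ′ = χ ; refines = λ _ _ eq → eq ; constant = λ _ _ eq _ → eq ; odd = λ { zero z≤n → odd } }
    refine (suc T) {c} χ odd = record
      { χ′ = R.χ′
      ; refines = λ v w → split-refines v w ∘ R.refines v w
      ; constant = constant
      ; odd = odd′ }
      where
      open Split _≟X_ _≟X_ χ (key (suc T)) (key T) (coarser T) odd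
      module R = Refinement (refine T split split-odd)
      constant : ∀ v w → χ v ≡ χ w → key (suc T) v ≡ key (suc T) w → R.χ′ v ≡ R.χ′ w
      constant v w χ≡ key≡ = R.constant v w (split-constant v w χ≡ key≡) (coarser T v w key≡)
      top : OddClasses _≟X_ R.χ′ (key (suc T))
      top i a with any? (λ v → (R.χ′ v ≟ i) ×-dec (key (suc T) v ≟X a))
      ... | no none = inj₁ (count-none λ v eq → let χv , kv = ∧⁻ ⌊ R.χ′ v ≟ i ⌋ eq in
                        none (v , ⌊⌋⁻ (R.χ′ v ≟ i) χv , ⌊⌋⁻ (key (suc T) v ≟X a) kv))
      -- A nonempty class at the level `suc T` is a whole class of `χ`, because all the splits that
      -- follow are constant on it.
      ... | yes (x , refl , refl) = subst ZeroOrOdd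
        (classSize-cong _≟X_ (λ v key≡ χ≡ → constant v x χ≡ key≡)
                             (λ v _ χ≡ → split-refines v x (R.refines v x χ≡)))
        (odd (χ x) (key (suc T) x))
      odd′ : ∀ t → t ≤ suc T → OddClasses _≟X_ R.χ′ (key t)
      odd′ t t≤ with m≤n⇒m<n∨m≡n t≤
      ... | inj₁ t<  = R.odd t (s≤s⁻¹ t<)
      ... | inj₂ refl = top

    -- The vertices themselves serve as finest classes, where every colour occurs at most once. The
    -- split from there to `key T` costs the factor 2 in front of the levels of `refine`.
    laminar-colouring : ∀ T {c} (χ : Fin l → Fin c) →
      ∃[ χ′ ] ((∀ v w → χ′ v ≡ χ′ w → χ v ≡ χ w) × (∀ t → t ≤ T → OddClasses {palette (c * 2) T} _≟X_ χ′ (key t)))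
    laminar-colouring T χ = R.χ′ , (λ v w → split-refines v w ∘ R.refines v w) , R.odd
      where
      singletons : OddClasses _≟_ χ (λ v → v)
      singletons i a with χ a ≟ i
      ... | yes χa = inj₂ (cong (_% 2) (≤-antisym (≤-trans (count-mono (λ v → proj₂ ∘ ∧⁻ ⌊ χ v ≟ i ⌋)) (count-≟ a))
                       (count-pos {p = λ v → ⌊ χ v ≟ i ⌋ ∧ ⌊ v ≟ a ⌋} a (∧⁺ (⌊⌋⁺ (χ a ≟ i) χa) (⌊⌋⁺ (a ≟ a) refl)))))
      ... | no χa≢i = inj₁ (count-none λ v eq → let χv , va = ∧⁻ ⌊ χ v ≟ i ⌋ eq in
                       χa≢i (trans (cong χ (≡-sym (⌊⌋⁻ (v ≟ a) va))) (⌊⌋⁻ (χ v ≟ i) χv)))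
      open Split _≟_ _≟X_ χ (λ v → v) (key T) (λ v w → cong (key T)) singletons
      module R = Refinement (refine T split split-odd)

-- Balls as subtrees

anyFin⁺ : ∀ {k} {p : Fin k → Bool} x → p x ≡ true → anyFin p ≡ true
anyFin⁺ zero    px = ∨⁺ˡ px
anyFin⁺ (suc x) px = ∨⁺ʳ (anyFin⁺ x px)

anyFin⁻ : ∀ {k} (p : Fin k → Bool) → anyFin p ≡ true → ∃[ x ] p x ≡ true
anyFin⁻ {suc k} p eq with ∨⁻ (p zero) eq
... | inj₁ p0 = zero , p0
... | inj₂ eq′ with anyFin⁻ (p ∘ suc) eq′
...   | x , px = suc x , px

within⁻ : ∀ G k u v → within G k u v ≡ true → WalkIn G (λ _ → true) k u v
within⁻ G zero u v eq with refl ← ⌊⌋⁻ (u ≟ v) eq = here refl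
within⁻ G (suc k) u v eq with ∨⁻ (within G k u v) eq
... | inj₁ near = walk-≤ (n≤1+n k) (within⁻ G k u v near)
... | inj₂ far with anyFin⁻ _ far
...   | w , eq′ with ∧⁻ (within G k u w) eq′
...     | near , e = walk-snoc (within⁻ G k u w near) e refl

within⁺ : ∀ {G A k} → ∀ j {u x v} → within G j u x ≡ true → WalkIn G A k x v → within G (j + k) u v ≡ true
within⁺ {k = zero} j w (here _) rewrite +-identityʳ j = w
within⁺ {G} {A} {suc k} j {u} {x} w (here Ax) rewrite +-suc j k =
  ∨⁺ˡ (within⁺ {G} {A} {k} j w (here Ax))
within⁺ {G} {A} {suc k} j {u} {x} w (step {y = y} _ e p) rewrite +-suc j k =
  within⁺ (suc j) (∨⁺ʳ (anyFin⁺ x (∧⁺ w e))) p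

within-mono : ∀ G {k l u v} → k ≤ l → within G k u v ≡ true → within G l u v ≡ true
within-mono G {k} {l} {u} {v} k≤l w =
  subst (λ i → within G i u v ≡ true) (m+[n∸m]≡n k≤l) (within⁺ {A = λ _ → true} k w (here refl))

tabulation : ∀ {V : Set} {a b e : ℕ} (Q : V → Fin a → Fin b → Fin e → Bool) →
             ∃[ code ] (∀ v w → (Fin (2 ^ (a * (b * e))) ∋ code v) ≡ code w → ∀ i j k → Q v i j k ≡ Q w i j k)
tabulation {V} {a} {b} {e} Q = (λ v → funToFin (bits v)) , agree
  where
  inner : V → Fin a → Fin b × Fin e → Fin 2
  inner v i (j , k) = bit (Q v i j k)
  outer : V → Fin a × Fin (b * e) → Fin 2
  outer v (i , y) = inner v i (remQuot e y)
  bits : V → Fin (a * (b * e)) → Fin 2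
  bits v x = outer v (remQuot (b * e) x)
  bits-at : ∀ v i j k → bits v (combine i (combine j k)) ≡ bit (Q v i j k)
  bits-at v i j k = trans (cong (outer v) (remQuot-combine i (combine j k))) (cong (inner v i) (remQuot-combine j k))
  agree : ∀ v w → funToFin (bits v) ≡ funToFin (bits w) → ∀ i j k → Q v i j k ≡ Q w i j k
  agree v w eq i j k = bit-injective (trans (≡-sym (bits-at v i j k)) (trans bits≡ (bits-at w i j k)))
    where
    x : Fin (a * (b * e))
    x = combine i (combine j k)
    bits≡ : bits v x ≡ bits w x
    bits≡ = trans (≡-sym (finToFun-funToFin (bits v) x)) (trans (cong (λ f → finToFun f x) eq) (finToFun-funToFin (bits w) x))

maybe-ext : ∀ {A : Set} {x y : Maybe A} → (∀ a → x ≡ just a → y ≡ just a) → (∀ a → y ≡ just a → x ≡ just a) → x ≡ y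
maybe-ext {x = just a}  f g = ≡-sym (f a refl)
maybe-ext {x = nothing} {just b}  f g = g b refl
maybe-ext {x = nothing} {nothing} f g = refl

ballPalette : ℕ → ℕ → ℕ → ℕ
ballPalette d K c = palette (c * 2 ^ (suc K * (c * suc d)) * 2) (suc K)

module Balls {G : Graph} (pos : Fin (n G) → ℕ) (pos-injective : ∀ x y → pos x ≡ pos y → x ≡ y)
             {d r c K : ℕ} (4d≤r : (d + d) + (d + d) ≤ r)
             (lab : Fin (n G) → Fin c) (lab-≢ : ∀ v s → v ≢ s → WeakReach.Reach G pos r v s → lab v ≢ lab s)
             (few : ∀ v → count (λ s → ⌊ WeakReach.reach? G pos d v s ⌋) ≤ K) where

  open WeakReach G pos

  private
    V : Set
    V = Fin (n G)

  -- The higher of `a` and `b` weakly reaches the lower one through `x` in at most `i + j` steps,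
  -- and then `lab` would tell them apart.
  unique : ∀ {i j x a b} → i + j ≤ r → Reach i x a → Reach j x b → lab a ≡ lab b → a ≡ b
  unique {i} {j} {x} {a} {b} le p q same with a ≟ b
  ... | yes a≡b = a≡b
  ... | no a≢b with ≤-total (pos a) (pos b)
  ...   | inj₁ a≤b = ⊥-elim (lab-≢ b a (a≢b ∘ ≡-sym)
            (walk-≤ (subst (_≤ r) (+-comm i j) le) (walk-++ (walk-above a≤b (walk-reverse q)) p)) (≡-sym same))
  ...   | inj₂ b≤a = ⊥-elim (lab-≢ a b a≢b
            (walk-≤ le (walk-++ (walk-above b≤a (walk-reverse p)) q)) same)

  rank : V → V → ℕ
  rank v a = count (λ s → ⌊ reach? d v s ⌋ ∧ ⌊ pos s <? pos a ⌋)

  rank-mono-< : ∀ {v a b} → Reach d v a → pos a < pos b → rank v a < rank v b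
  rank-mono-< {v} {a} {b} p a<b = count-mono-< widen a
    (¬-not λ eq → <-irrefl refl (⌊⌋⁻ (pos a <? pos a) (proj₂ (∧⁻ ⌊ reach? d v a ⌋ eq))))
    (∧⁺ (⌊⌋⁺ (reach? d v a) p) (⌊⌋⁺ (pos a <? pos b) a<b))
    where
    widen : ∀ s → ⌊ reach? d v s ⌋ ∧ ⌊ pos s <? pos a ⌋ ≡ true → ⌊ reach? d v s ⌋ ∧ ⌊ pos s <? pos b ⌋ ≡ true
    widen s eq with ∧⁻ ⌊ reach? d v s ⌋ eq
    ... | q , s<a = ∧⁺ q (⌊⌋⁺ (pos s <? pos b) (<-trans (⌊⌋⁻ (pos s <? pos a) s<a) a<b))

  -- The `k`-th lowest vertex, counted from zero, that `v` weakly `d`-reaches. Since `rank v` is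
  -- injective on these vertices, `find` has no choice to make.
  slot : ℕ → V → Maybe V
  slot k v = find (λ a → ⌊ reach? d v a ⌋ ∧ ⌊ rank v a ≟ℕ k ⌋)

  slot-sound : ∀ {k v a} → slot k v ≡ just a → Reach d v a × rank v a ≡ k
  slot-sound {k} {v} {a} eq with ∧⁻ ⌊ reach? d v a ⌋ (find-sound (λ a → ⌊ reach? d v a ⌋ ∧ ⌊ rank v a ≟ℕ k ⌋) eq)
  ... | p , rk = ⌊⌋⁻ (reach? d v a) p , ⌊⌋⁻ (rank v a ≟ℕ k) rk

  slot-reach : ∀ {k v a} → slot k v ≡ just a → Reach d v a
  slot-reach {k} {v} = proj₁ ∘ slot-sound {k} {v}

  slot-mono : ∀ {k l v a b} → k ≤ l → slot k v ≡ just a → slot l v ≡ just b → pos a ≤ pos b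
  slot-mono {k} {l} {v} k≤l ka lb with slot-sound {k} {v} ka | slot-sound {l} {v} lb
  ... | _ , refl | q , refl = ≮⇒≥ λ b<a → <⇒≱ (rank-mono-< q b<a) k≤l

  slot-complete : ∀ {v a} → Reach d v a → slot (rank v a) v ≡ just a
  slot-complete {v} {a} p
    with find-complete (λ b → ⌊ reach? d v b ⌋ ∧ ⌊ rank v b ≟ℕ rank v a ⌋) a
           (∧⁺ (⌊⌋⁺ (reach? d v a) p) (⌊⌋⁺ (rank v a ≟ℕ rank v a) refl))
  ... | b , eq with slot-sound {rank v a} {v} eq
  ...   | q , same with <-cmp (pos a) (pos b)
  ...     | tri< a<b _ _ = ⊥-elim (<⇒≢ (rank-mono-< p a<b) (≡-sym same))
  ...     | tri> _ _ b<a = ⊥-elim (<⇒≢ (rank-mono-< q b<a) same)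
  ...     | tri≈ _ a≡b _ = trans eq (cong just (≡-sym (pos-injective a b a≡b)))

  slot-< : ∀ {k v a} → slot k v ≡ just a → k < suc K
  slot-< {k} {v} {a} eq with slot-sound {k} {v} eq
  ... | _ , refl = s≤s (≤-trans (count-mono (λ s → proj₁ ∘ ∧⁻ ⌊ reach? d v s ⌋)) (few v))

  -- The vertex `a` enters only through its label, so that profiles of different vertices can be
  -- compared; `i` remembers how close to `v` it is.
  Profile : V → ℕ → Fin c → ℕ → Set
  Profile v k j i = ∃[ a ] (slot k v ≡ just a × lab a ≡ j × Reach i v a)

  profile? : ∀ v k j i → Dec (Profile v k j i)
  profile? v k j i = any? (λ a → Maybe-≡-dec _≟_ (slot k v) (just a) ×-dec ((lab a ≟ j) ×-dec reach? i v a))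

  profileBit : V → Fin (suc K) → Fin c → Fin (suc d) → Bool
  profileBit v k j i = ⌊ profile? v (toℕ k) j (toℕ i) ⌋

  code : V → Fin (2 ^ (suc K * (c * suc d)))
  code = proj₁ (tabulation profileBit)

  type : V → Fin (c * 2 ^ (suc K * (c * suc d)))
  type v = combine (lab v) (code v)

  type-profile : ∀ {v w k j i} → type v ≡ type w → i ≤ d → Profile v k j i → Profile w k j i
  type-profile {v} {w} {k} {j} {i} eq i≤d prof@(a , ka , _) =
    subst₂ (λ k i → Profile w k j i) (toℕ-fromℕ< k<) (toℕ-fromℕ< (s≤s i≤d))
      (⌊⌋⁻ (profile? w (toℕ k′) j (toℕ i′)) (trans (≡-sym same) (⌊⌋⁺ (profile? v (toℕ k′) j (toℕ i′)) prof′)))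
    where
    k< : k < suc K
    k< = slot-< {k} {v} ka
    k′ : Fin (suc K)
    k′ = fromℕ< k<
    i′ : Fin (suc d)
    i′ = fromℕ< (s≤s i≤d)
    prof′ : Profile v (toℕ k′) j (toℕ i′)
    prof′ = subst₂ (λ k i → Profile v k j i) (≡-sym (toℕ-fromℕ< k<)) (≡-sym (toℕ-fromℕ< (s≤s i≤d))) prof
    same : profileBit v k′ j i′ ≡ profileBit w k′ j i′
    same = proj₂ (tabulation profileBit) v w (combine-injectiveʳ (lab v) _ (lab w) _ eq) k′ j i′

  -- The type provides some `l`-th vertex of `w` with the label of `e`. Both lie at or below `a` and
  -- are weakly reached from it, one via `v` and the other via `w`, each within `d + d`, so `unique`
  -- identifies them.
  slot-determined : ∀ {v w k l a e} → type v ≡ type w → slot k v ≡ just a → slot k w ≡ just a → l ≤ k →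
                    slot l v ≡ just e → slot l w ≡ just e
  slot-determined {v} {w} {k} {l} {a} {e} eq kv kw l≤k lv =
    let e′ , lw , same , q = type-profile {v} {w} {l} eq ≤-refl (e , lv , refl , slot-reach {l} {v} lv) in
    trans lw (cong just (unique 4d≤r (via w kw lw q) (via v kv lv (slot-reach {l} {v} lv)) same))
    where
    via : ∀ x {b} → slot k x ≡ just a → slot l x ≡ just b → Reach d x b → Reach (d + d) a b
    via x kx lx q = walk-++ (walk-above (slot-mono {l} {k} {x} l≤k lx kx) (walk-reverse (slot-reach {k} {x} kx))) q

  -- A node of the forest is named by its slot together with all lower slots. The newest slot stands
  -- at the head, so dropping the head leads to the coarser level.
  key : ℕ → V → List (Maybe V)
  key zero    v = []
  key (suc k) v = slot k v ∷ key k v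

  key-determined : ∀ {v w k a} → type v ≡ type w → slot k v ≡ just a → slot k w ≡ just a →
                   ∀ l → l ≤ suc k → key l v ≡ key l w
  key-determined eq kv kw zero _ = refl
  key-determined {v} {w} {k} eq kv kw (suc l) l<k = cong₂ _∷_
    (maybe-ext (λ e → slot-determined {v} {w} {k} {l} eq kv kw (s≤s⁻¹ l<k))
               (λ e → slot-determined {w} {v} {k} {l} (≡-sym eq) kw kv (s≤s⁻¹ l<k)))
    (key-determined {v} {w} {k} eq kv kw l (<⇒≤ l<k))

  _≟K_ : DecidableEquality (List (Maybe V))
  _≟K_ = List-≡-dec (Maybe-≡-dec _≟_)

  module _ {C : ℕ} (χ : V → Fin C) (χ-type : ∀ v w → χ v ≡ χ w → type v ≡ type w)
           (odd : ∀ t → t ≤ suc K → OddClasses _≟K_ χ (key t)) (u : V) (i : Fin C) where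

    record Meets (k : ℕ) : Set where
      field
        {v a}    : V
        {p q}    : ℕ
        colour   : χ v ≡ i
        slotted  : slot k v ≡ just a
        from-u   : Reach p u a
        from-v   : Reach q v a
        short    : p + q ≤ d

    meets : ∀ v → χ v ≡ i → within G d u v ≡ true → ∃[ k ] ∃[ m ] Meets.v {k} m ≡ v
    meets v χv near with lowest (within⁻ G d u v near)
    ... | a , p , q , le , ua , av = _ , record
      { colour = χv ; slotted = slot-complete (walk-≤ (≤-trans (m≤n+m q p) le) (walk-reverse av))
      ; from-u = ua ; from-v = walk-reverse av ; short = le } , refl

    -- For the smallest k, the ball of u meets colour i in the class of all vertices sharing the k-th slot.
    meets-odd : ∀ k → Meets k → ¬ ¬ ZeroOrOdd (ballColorCount G χ d u i)
    meets-odd = <-rec _ λ k rec m bad → minimal k (λ l<k m′ → rec l<k m′ bad) m bad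
      where
      minimal : ∀ k → (∀ {l} → l < k → ¬ Meets l) → Meets k → ¬ ¬ ZeroOrOdd (ballColorCount G χ d u i)
      -- `key (suc k)` is the shortest key that contains slot `k`, and `slot-<` is precisely
      -- `suc k ≤ suc K`.
      minimal k least m bad = bad (subst ZeroOrOdd (count-cong from to) (odd (suc k) (slot-< {k} {v} slotted) i (key (suc k) v)))
        where
        open Meets m
        p≤d : p ≤ d
        p≤d = ≤-trans (m≤m+n p q) short
        q≤d : q ≤ d
        q≤d = ≤-trans (m≤n+m q p) short
        from : ∀ w → ⌊ χ w ≟ i ⌋ ∧ ⌊ key (suc k) w ≟K key (suc k) v ⌋ ≡ true → within G d u w ∧ ⌊ χ w ≟ i ⌋ ≡ true
        from w eq =
          let χw , kw         = ∧⁻ ⌊ χ w ≟ i ⌋ eq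
              slot≡           = ∷-injectiveˡ (⌊⌋⁻ (key (suc k) w ≟K key (suc k) v) kw)
              types           = χ-type v w (trans colour (≡-sym (⌊⌋⁻ (χ w ≟ i) χw)))
              -- The profile keeps the depth `q`, so `a` is within `q` of `w` too and not merely
              -- within `d`; together with `p` this stays inside the ball.
              b , kb , _ , wb = type-profile {v} {w} {k} types q≤d (a , slotted , refl , from-v)
              b≡a             = just-injective (trans (≡-sym kb) (trans slot≡ slotted))
              wa              = subst (Reach q w) b≡a wb
          in ∧⁺ (within-mono G short (within⁺ 0 (⌊⌋⁺ (u ≟ u) refl) (walk-++ from-u (walk-reverse wa)))) χw
        to : ∀ w → within G d u w ∧ ⌊ χ w ≟ i ⌋ ≡ true → ⌊ χ w ≟ i ⌋ ∧ ⌊ key (suc k) w ≟K key (suc k) v ⌋ ≡ true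
        to w eq with ∧⁻ (within G d u w) eq
        ... | near , χw with meets w (⌊⌋⁻ (χ w ≟ i) χw) near
        ...   | l , m′ , refl = ∧⁺ χw (⌊⌋⁺ (key (suc k) w ≟K key (suc k) v)
                                    (key-determined {w} {v} {k} (≡-sym types) slot-w slotted (suc k) ≤-refl))
          where
          module M′ = Meets m′
          types : type v ≡ type w
          types = χ-type v w (trans colour (≡-sym M′.colour))
          k≤l : k ≤ l
          k≤l = ≮⇒≥ λ l<k → least l<k m′
          slot-w : slot k w ≡ just a
          slot-w =
            -- Minimality of `k` puts the `k`-th vertex `b` of `w` at or below the lowest vertex of
            -- the walk from `u` to `w`. So `u` weakly reaches `b` through `w`, and `a` directly,
            -- and equal labels give `b ≡ a`.
            let b , kb , same , _ = type-profile {v} {w} {k} types q≤d (a , slotted , refl , from-v)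
                b≤a′ = slot-mono {k} {l} {w} k≤l kb M′.slotted
                ub   = walk-++ (walk-above b≤a′ (walk-++ M′.from-u (walk-reverse M′.from-v))) (slot-reach {k} {w} kb)
            in trans kb (cong just (unique le ub from-u same))
            where
            le : M′.p + M′.q + d + p ≤ r
            le = ≤-trans (+-mono-≤ (+-monoˡ-≤ d M′.short) (≤-trans p≤d (m≤m+n d d))) 4d≤r

    ball-odd : ZeroOrOdd (ballColorCount G χ d u i)
    ball-odd with 0 <? ballColorCount G χ d u i
    ... | no none = inj₁ (n≤0⇒n≡0 (≮⇒≥ none))
    ... | yes some =
      let v , eq    = count-witness some
          near , χv = ∧⁻ (within G d u v) eq
          k , m , _ = meets v (⌊⌋⁻ (χ v ≟ i) χv) near
      in zeroOrOdd-stable (ballColorCount G χ d u i) (meets-odd k m)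

-- Choice of the constants and the final colouring

depth : ℕ → ℕ
depth d = suc ((d + d) + (d + d))

reachLimit : ℕ → ℕ → ℕ
reachLimit d N = reachBound (hittingBound (depth d) N) (depth d)

-- Colours refine types and types refine labels, so properness is inherited from the labels.
odd-ball-colouring : ∀ d N G → MinorDensity G (depth d + depth d) N →
  ∃[ col ] (Proper G {ballPalette d (reachLimit d N) (suc (reachLimit d N))} col ×
            (∀ u i → ZeroOrOdd (ballColorCount G col d u i)))
odd-ball-colouring d N G bound =
  let χ , χ-type , odd = laminar-colouring _≟K_ key (λ _ _ _ → ∷-injectiveʳ) (suc K) type
  in χ , (λ u v e eq → lab-proper u v e (combine-injectiveˡ (lab u) _ (lab v) _ (χ-type u v eq)))
       , ball-odd χ χ-type odd
  where
  r : ℕ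
  r = depth d
  K : ℕ
  K = reachLimit d N
  ord : Ordering G (hittingBound r N) r (λ _ → true)
  ord = ordering {G} {r} {N} bound (n G) (λ _ → true) count-all
  open Ordering ord using (pos; pos-injective)
  open WeakReach G pos
  d≤r : d ≤ r
  d≤r = ≤-trans (m≤m+n d d) (≤-trans (m≤m+n (d + d) (d + d)) (n≤1+n _))
  few : ∀ v → count (λ s → ⌊ reach? r v s ⌋) ≤ K
  few = count-reach ord r ≤-refl
  colouring : ∃[ lab ] (∀ v s → v ≢ s → Reach r v s → lab v ≢ (Fin (suc K) ∋ lab s))
  colouring = reach-colouring ord few
  lab : Fin (n G) → Fin (suc K)
  lab = proj₁ colouring
  open Balls {G} pos (λ x y → pos-injective x y refl refl) {d} {r} {suc K} {K} (n≤1+n _) lab (proj₂ colouring)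
    (λ v → ≤-trans (count-mono (λ s → ⌊⌋⁺ (reach? r v s) ∘ walk-≤ d≤r ∘ ⌊⌋⁻ (reach? d v s))) (few v))

  lab-≢ : ∀ u v → adj G u v ≡ true → pos v ≤ pos u → lab u ≢ lab v
  -- An edge is a walk of length one; the `suc` in `depth` leaves room for it even if `d` is zero.
  lab-≢ u v e v≤u = proj₂ colouring u v u≢v (step (≤ᵇ⁺ v≤u) e reach-refl)
    where
    u≢v : u ≢ v
    u≢v refl with () ← trans (≡-sym e) (irr G u)

  lab-proper : ∀ u v → adj G u v ≡ true → lab u ≢ lab v
  lab-proper u v e with ≤-total (pos v) (pos u)
  ... | inj₁ v≤u = lab-≢ u v e v≤u
  ... | inj₂ u≤v = lab-≢ v u (trans (sym G v u) e) u≤v ∘ ≡-sym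

theorem1p2 : (d : ℕ) (C : GraphClass) → BoundedExpansion C →
    ∃[ c ] (∀ (G : Graph) → C G →
    ∃[ col ] (Proper G {c} col ×
    (∀ (u : Fin (n G)) (i : Fin c) → ZeroOrOdd (ballColorCount G col d u i))))
theorem1p2 d C expansion =
  -- Cells have radius twice the length of the walks to be hit, hence minors of twice the depth.
  let N , bound = expansion (depth d + depth d) in
  ballPalette d (reachLimit d N) (suc (reachLimit d N)) , λ G G∈C → odd-ball-colouring d N G (bound G G∈C)
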